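{- $(\mathbf V_m, \eta, \_^\dagger, t)$ is a commutative monad on the category $\mathbf{Dcpo}$ of dcpos and Scott-continuous maps.
   Context: $\overline{\mathbb R}_+ = [0,+\infty]$, with $0\cdot(+\infty)=0$. Every dcpo is equipped with its Scott topology, and $\mathcal O X$ denotes the lattice of open subsets of $X$. A continuous valuation on $X$ is a Scott-continuous map $\nu \colon \mathcal O X \to \overline{\mathbb R}_+$ with $\nu(\emptyset)=0$ and $\nu(U\cup V)+\nu(U\cap V)=\nu(U)+\nu(V)$. $\mathbf V X$ is the dcpo of continuous valuations on $X$, ordered pointwise. For continuous $h\colon X\to\overline{\mathbb R}_+$ (Scott topology), $\int h\,d\nu = \int_0^{+\infty}\nu(h^{ -1}(]t,+\infty]))\,dt$ (Riemann integral). A simple valuation is a finite linear combination $\sum_{i=1}^n r_i\delta_{x_i}$ of Dirac valuations with $r_i\in\mathbb R_+$. The set $\mathbf V_m X$ of minimal valuations is the smallest subset of $\mathbf V X$ containing all simple valuations and closed under directed suprema taken in $\mathbf V X$; it is ordered pointwise. A monad $(T,\eta,\_^\dagger)$ (Manes' presentation) is a function $T$ on objects, with morphisms $\eta_X\colon X\to TX$ and, for each $f\colon X\to TY$, a morphism $f^\dagger\colon TX\to TY$, such that $f^\dagger\circ\eta_X=f$, $\eta_X^\dagger=\mathrm{id}_{TX}$ and $(g^\dagger\circ f)^\dagger=g^\dagger\circ f^\dagger$. Here $\eta_X(x)=\delta_x$, and $f^\dagger(\mu)(V)=\int_{x\in X} f(x)(V)\,d\mu$. A tensorial strength $t$ for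 $T$ on a category with finite products is a family $t_{X,Y}\colon X\times TY\to T(X\times Y)$, natural in $X$ and $Y$, satisfying the usual (Moggi) coherence conditions with respect to the product structure and the monad. Here $t_{X,Y}(x,\nu)(W)=\nu(\{y\in Y\mid (x,y)\in W\})$ for every open $W\subseteq X\times Y$ (product in $\mathbf{Dcpo}$). The dual strength $t'_{X,Y}\colon TX\times Y\to T(X\times Y)$ is obtained from $t$ by swapping the two arguments and swapping back. A strong monad is commutative when ${t'}^\dagger_{X,Y}\circ t_{TX,Y} = t^\dagger_{X,Y}\circ t'_{X,TY}$ as morphisms $TX\times TY\to T(X\times Y)$, for all $X,Y$. -}

module Defs where

open import Level using (Level; Lift; lift; lower) renaming (suc to lsuc)
open import Data.Fin.Base using (Fin)
open import Data.List.Base using (List; []; _∷_)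
open import Data.Nat.Base using (ℕ)
open import Data.Product.Base using (Σ-syntax; ∃-syntax; _×_; _,_; proj₁; proj₂)
open import Data.Product.Relation.Binary.Pointwise.NonDependent using (×-poset)
open import Data.Rational.Base using (ℚ; 0ℚ; 1ℚ; ½; _<_; _≤_; _+_; _*_)
import Data.Rational.Properties as ℚ
open import Data.Sum.Base using (_⊎_; inj₁; inj₂)
import Data.Empty.Polymorphic as Empty
import Data.Unit.Polymorphic as Unit
import Data.Vec.Functional as Vector
open import Relation.Binary.Bundles using (Poset)
import Relation.Binary.Construct.Interior.Symmetric as Interior
open import Relation.Binary.PropositionalEquality.Core using (_≡_; sym; trans)
open import Relation.Nullary.Negation.Core using (¬_)

private variable
  ℓ : Level

-- In a predicative theory "all directed subsets" has to be relativised
-- to a universe: directed families are indexed by types in Set ℓ and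
-- open subsets are Set ℓ-valued predicates, while carriers and orders
-- live one universe higher, so that the valuations on a dcpo again form
-- a dcpo of the same kind.  A dcpo with carrier in Set ℓ is covered by
-- lifting it.  Equality of elements is the equality _≈_ of the poset.

record Directed (P : Poset (lsuc ℓ) (lsuc ℓ) (lsuc ℓ)) {I : Set ℓ}
                (d : I → Poset.Carrier P) : Set (lsuc ℓ) where
  open Poset P using () renaming (_≤_ to _⊑_)
  field
    inhabitant : I
    bounded    : ∀ i j → ∃[ k ] (d i ⊑ d k) × (d j ⊑ d k)

record IsLub (P : Poset (lsuc ℓ) (lsuc ℓ) (lsuc ℓ)) {I : Set ℓ}
             (d : I → Poset.Carrier P) (s : Poset.Carrier P) : Set (lsuc ℓ) where
  open Poset P using () renaming (_≤_ to _⊑_)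
  field
    upper : ∀ i → d i ⊑ s
    least : ∀ u → (∀ i → d i ⊑ u) → s ⊑ u

record DCPO (ℓ : Level) : Set (lsuc (lsuc ℓ)) where
  no-eta-equality
  field
    poset : Poset (lsuc ℓ) (lsuc ℓ) (lsuc ℓ)
  open Poset poset public using (Carrier; _≈_) renaming
    ( _≤_ to _⊑_; refl to ⊑-refl; trans to ⊑-trans; reflexive to ⊑-reflexive
    ; antisym to ⊑-antisym; module Eq to ≈)
  field
    ⋁       : {I : Set ℓ} (d : I → Carrier) → Directed poset d → Carrier
    ⋁-isLub : {I : Set ℓ} (d : I → Carrier) (dir : Directed poset d) →
              IsLub poset d (⋁ d dir)

open DCPO using (Carrier)

infixr 1 _⇒_
infixr 9 _∘_
infix  4 _≐_
infixr 2 _⊗₁_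

record _⇒_ (X Y : DCPO ℓ) : Set (lsuc ℓ) where
  private
    module X = DCPO X
    module Y = DCPO Y
  field
    to         : X.Carrier → Y.Carrier
    monotone   : ∀ {x y} → x X.⊑ y → to x Y.⊑ to y
    continuous : {I : Set ℓ} (d : I → X.Carrier) (dir : Directed X.poset d) →
                 IsLub Y.poset (λ i → to (d i)) (to (X.⋁ d dir))

open _⇒_ public using (to)

_≐_ : {X Y : DCPO ℓ} → X ⇒ Y → X ⇒ Y → Set (lsuc ℓ)
_≐_ {X = X} {Y = Y} f g = ∀ x → DCPO._≈_ Y (to f x) (to g x)

private
  directed-map : {X Y : DCPO ℓ} (f : Carrier X → Carrier Y) →
    (∀ {x y} → DCPO._⊑_ X x y → DCPO._⊑_ Y (f x) (f y)) →
    {I : Set ℓ} {d : I → Carrier X} → Directed (DCPO.poset X) d →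
    Directed (DCPO.poset Y) (λ i → f (d i))
  directed-map f mono dir = record
    { inhabitant = Directed.inhabitant dir
    ; bounded    = λ i j → let k , p , q = Directed.bounded dir i j in k , mono p , mono q
    }

id : (X : DCPO ℓ) → X ⇒ X
id X = record { to = λ x → x ; monotone = λ p → p ; continuous = DCPO.⋁-isLub X }

_∘_ : {X Y Z : DCPO ℓ} → Y ⇒ Z → X ⇒ Y → X ⇒ Z
_∘_ {X = X} {Y} {Z} g f = record
  { to         = λ x → to g (to f x)
  ; monotone   = λ p → g.monotone (f.monotone p)
  ; continuous = λ d dir → let
      dir′ = directed-map {X = X} {Y} (to f) f.monotone dir
      lub  = g.continuous (λ i → to f (d i)) dir′
    in record
      { upper = λ i → g.monotone (IsLub.upper (f.continuous d dir) i)
      ; least = λ u ub → DCPO.⊑-trans Z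
          (g.monotone (IsLub.least (f.continuous d dir) _
            (IsLub.upper (DCPO.⋁-isLub Y (λ i → to f (d i)) dir′))))
          (IsLub.least lub u ub)
      }
  }
  where
  module f = _⇒_ f
  module g = _⇒_ g

𝟏 : DCPO ℓ
𝟏 .DCPO.poset       = Interior.poset {A = Unit.⊤} {R = λ _ _ → Unit.⊤} _ _
𝟏 .DCPO.⋁ _ _       = _
𝟏 .DCPO.⋁-isLub _ _ = record {}

module _ (X Y : DCPO ℓ) where
  private
    module X = DCPO X
    module Y = DCPO Y
    P = ×-poset X.poset Y.poset

    dir₁ : ∀ {I} {d : I → Poset.Carrier P} → Directed P d → Directed X.poset (λ i → proj₁ (d i))
    dir₁ dir = record
      { inhabitant = Directed.inhabitant dir
      ; bounded    = λ i j → let k , p , q = Directed.bounded dir i j in k , proj₁ p , proj₁ q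
      }

    dir₂ : ∀ {I} {d : I → Poset.Carrier P} → Directed P d → Directed Y.poset (λ i → proj₂ (d i))
    dir₂ dir = record
      { inhabitant = Directed.inhabitant dir
      ; bounded    = λ i j → let k , p , q = Directed.bounded dir i j in k , proj₂ p , proj₂ q
      }

  infixr 2 _⊗_
  _⊗_ : DCPO ℓ
  _⊗_ .DCPO.poset         = P
  _⊗_ .DCPO.⋁ d dir       = X.⋁ (λ i → proj₁ (d i)) (dir₁ dir) , Y.⋁ (λ i → proj₂ (d i)) (dir₂ dir)
  _⊗_ .DCPO.⋁-isLub d dir = record
    { upper = λ i → IsLub.upper l₁ i , IsLub.upper l₂ i
    ; least = λ u ub → IsLub.least l₁ (proj₁ u) (λ i → proj₁ (ub i))
                     , IsLub.least l₂ (proj₂ u) (λ i → proj₂ (ub i))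
    }
    where
    l₁ = X.⋁-isLub (λ i → proj₁ (d i)) (dir₁ dir)
    l₂ = Y.⋁-isLub (λ i → proj₂ (d i)) (dir₂ dir)

π₁ : (X Y : DCPO ℓ) → X ⊗ Y ⇒ X
π₁ X Y = record
  { to         = proj₁
  ; monotone   = proj₁
  ; continuous = λ d dir → DCPO.⋁-isLub X (λ i → proj₁ (d i)) _
  }

π₂ : (X Y : DCPO ℓ) → X ⊗ Y ⇒ Y
π₂ X Y = record
  { to         = proj₂
  ; monotone   = proj₂
  ; continuous = λ d dir → DCPO.⋁-isLub Y (λ i → proj₂ (d i)) _
  }

⟨_,_⟩ : {X Y Z : DCPO ℓ} → Z ⇒ X → Z ⇒ Y → Z ⇒ X ⊗ Y
⟨ f , g ⟩ = record
  { to         = λ z → to f z , to g z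
  ; monotone   = λ p → _⇒_.monotone f p , _⇒_.monotone g p
  ; continuous = λ d dir → let
      l₁ = _⇒_.continuous f d dir
      l₂ = _⇒_.continuous g d dir
    in record
      { upper = λ i → IsLub.upper l₁ i , IsLub.upper l₂ i
      ; least = λ u ub → IsLub.least l₁ (proj₁ u) (λ i → proj₁ (ub i))
                       , IsLub.least l₂ (proj₂ u) (λ i → proj₂ (ub i))
      }
  }

_⊗₁_ : {X X′ Y Y′ : DCPO ℓ} → X ⇒ X′ → Y ⇒ Y′ → X ⊗ Y ⇒ X′ ⊗ Y′
_⊗₁_ {X = X} {Y = Y} f g = ⟨ f ∘ π₁ X Y , g ∘ π₂ X Y ⟩

swap : (X Y : DCPO ℓ) → X ⊗ Y ⇒ Y ⊗ X
swap X Y = ⟨ π₂ X Y , π₁ X Y ⟩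

assoc : (X Y Z : DCPO ℓ) → (X ⊗ Y) ⊗ Z ⇒ X ⊗ (Y ⊗ Z)
assoc X Y Z = ⟨ π₁ X Y ∘ π₁ (X ⊗ Y) Z , ⟨ π₂ X Y ∘ π₁ (X ⊗ Y) Z , π₂ (X ⊗ Y) Z ⟩ ⟩

-- †-cong expresses that _† is a function on morphisms, which are
-- identified when they are pointwise equal.
record Monad (T : DCPO ℓ → DCPO ℓ) : Set (lsuc (lsuc ℓ)) where
  infix 10 _†
  field
    η   : (X : DCPO ℓ) → X ⇒ T X
    _†  : {X Y : DCPO ℓ} → X ⇒ T Y → T X ⇒ T Y

    †-cong : {X Y : DCPO ℓ} {f g : X ⇒ T Y} → f ≐ g → f † ≐ g †
    †-η    : {X Y : DCPO ℓ} (f : X ⇒ T Y) → f † ∘ η X ≐ f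
    η-†    : (X : DCPO ℓ) → η X † ≐ id (T X)
    †-∘    : {X Y Z : DCPO ℓ} (f : X ⇒ T Y) (g : Y ⇒ T Z) → (g † ∘ f) † ≐ g † ∘ f †

  fmap : {X Y : DCPO ℓ} → X ⇒ Y → T X ⇒ T Y
  fmap f = (η _ ∘ f) †

  join : (X : DCPO ℓ) → T (T X) ⇒ T X
  join X = id (T X) †

record Strength {T : DCPO ℓ → DCPO ℓ} (M : Monad T) : Set (lsuc (lsuc ℓ)) where
  open Monad M
  field
    t : (X Y : DCPO ℓ) → X ⊗ T Y ⇒ T (X ⊗ Y)

    natural  : {X X′ Y Y′ : DCPO ℓ} (f : X ⇒ X′) (g : Y ⇒ Y′) →
               fmap (f ⊗₁ g) ∘ t X Y ≐ t X′ Y′ ∘ (f ⊗₁ fmap g)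
    t-unit   : (X : DCPO ℓ) → fmap (π₂ 𝟏 X) ∘ t 𝟏 X ≐ π₂ 𝟏 (T X)
    t-assoc  : (X Y Z : DCPO ℓ) →
               fmap (assoc X Y Z) ∘ t (X ⊗ Y) Z ≐ t X (Y ⊗ Z) ∘ (id X ⊗₁ t Y Z) ∘ assoc X Y (T Z)
    t-η      : (X Y : DCPO ℓ) → t X Y ∘ (id X ⊗₁ η Y) ≐ η (X ⊗ Y)
    t-join   : (X Y : DCPO ℓ) →
               t X Y ∘ (id X ⊗₁ join Y) ≐ join (X ⊗ Y) ∘ fmap (t X Y) ∘ t X (T Y)

  t′ : (X Y : DCPO ℓ) → T X ⊗ Y ⇒ T (X ⊗ Y)
  t′ X Y = fmap (swap Y X) ∘ t Y X ∘ swap (T X) Y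

record CommutativeMonad (T : DCPO ℓ → DCPO ℓ) : Set (lsuc (lsuc ℓ)) where
  field
    monad    : Monad T
    strength : Strength monad
  open Monad monad public
  open Strength strength public
  field
    commutative : (X Y : DCPO ℓ) → t′ X Y † ∘ t (T X) Y ≐ t X Y † ∘ t′ X (T Y)

-- An extended non-negative real r is represented by the set of all rationals q < r; the
-- negative rationals always belong to it, and the set of all rationals
-- is +∞.

record [0,∞] (ℓ : Level) : Set (lsuc ℓ) where
  field
    Below    : ℚ → Set ℓ
    negative : ∀ {q} → q < 0ℚ → Below q
    downward : ∀ {p q} → p < q → Below q → Below p
    rounded  : ∀ {p} → Below p → ∃[ q ] (p < q) × Below q

open [0,∞] public using (Below)

infix  4 _≤∞_
infixl 6 _+∞_
infixl 7 _·∞_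

record _≤∞_ (r s : [0,∞] ℓ) : Set (lsuc ℓ) where
  constructor ≤∞-intro
  field ≤∞-elim : ∀ {q} → Below r q → Below s q

open _≤∞_ public

≤∞-poset : (ℓ : Level) → Poset (lsuc ℓ) (lsuc ℓ) (lsuc ℓ)
≤∞-poset ℓ = Interior.poset {R = _≤∞_ {ℓ}}
  (≤∞-intro λ p → p) (λ p q → ≤∞-intro λ b → ≤∞-elim q (≤∞-elim p b))

sup : {I : Set ℓ} → I → (I → [0,∞] ℓ) → [0,∞] ℓ
sup i₀ r = record
  { Below    = λ q → ∃[ i ] Below (r i) q
  ; negative = λ q<0 → i₀ , [0,∞].negative (r i₀) q<0
  ; downward = λ p<q (i , b) → i , [0,∞].downward (r i) p<q b
  ; rounded  = λ (i , b) → let q , p<q , b′ = [0,∞].rounded (r i) b in q , p<q , i , b′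
  }

𝐑 : DCPO ℓ
𝐑 {ℓ} .DCPO.poset     = ≤∞-poset ℓ
𝐑 .DCPO.⋁ d dir       = sup (Directed.inhabitant dir) d
𝐑 .DCPO.⋁-isLub d dir = record
  { upper = λ i → ≤∞-intro λ b → i , b
  ; least = λ u ub → ≤∞-intro λ (i , b) → ≤∞-elim (ub i) b
  }

-- 1 if A holds, and 0 otherwise.
[_] : Set ℓ → [0,∞] ℓ
[ A ] = record
  { Below    = λ q → q < 0ℚ ⊎ (A × q < 1ℚ)
  ; negative = λ q<0 → inj₁ q<0
  ; downward = λ { p<q (inj₁ q<0) → inj₁ (ℚ.<-trans p<q q<0)
                 ; p<q (inj₂ (a , q<1)) → inj₂ (a , ℚ.<-trans p<q q<1) }
  ; rounded  = λ { (inj₁ p<0) → let q , p<q , q<0 = ℚ.<-dense p<0 in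
                                q , p<q , inj₁ q<0
                 ; (inj₂ (a , p<1)) → let q , p<q , q<1 = ℚ.<-dense p<1 in
                                      q , p<q , inj₂ (a , q<1) }
  }

0∞ : [0,∞] ℓ
0∞ = [ Empty.⊥ ]

ℚ₊ : Set
ℚ₊ = Σ[ q ∈ ℚ ] 0ℚ ≤ q

fromℚ₊ : ℚ₊ → [0,∞] ℓ
fromℚ₊ {ℓ} (r , 0≤r) = record
  { Below    = λ q → Lift ℓ (q < r)
  ; negative = λ q<0 → lift (ℚ.<-≤-trans q<0 0≤r)
  ; downward = λ p<q (lift q<r) → lift (ℚ.<-trans p<q q<r)
  ; rounded  = λ (lift p<r) → let q , p<q , q<r = ℚ.<-dense p<r in q , p<q , lift q<r
  }

_+∞_ : [0,∞] ℓ → [0,∞] ℓ → [0,∞] ℓ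
r +∞ s = record
  { Below    = λ q → ∃[ a ] ∃[ b ] Below r a × Below s b × q ≤ a + b
  ; negative = λ {q} q<0 →
      q * ½ , q * ½ , r.negative (half<0 q<0) , s.negative (half<0 q<0) ,
      ℚ.≤-reflexive (sym (halves q))
  ; downward = λ p<q (a , b , ra , sb , q≤a+b) →
      a , b , ra , sb , ℚ.≤-trans (ℚ.<⇒≤ p<q) q≤a+b
  ; rounded  = λ (a , b , ra , sb , p≤a+b) → let a′ , a<a′ , ra′ = r.rounded ra in
      a′ + b , ℚ.≤-<-trans p≤a+b (ℚ.+-monoˡ-< b a<a′) , a′ , b , ra′ , sb , ℚ.≤-refl
  }
  where
  module r = [0,∞] r
  module s = [0,∞] s
  half<0 : ∀ {q} → q < 0ℚ → q * ½ < 0ℚ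
  half<0 q<0 = ℚ.*-monoˡ-<-pos ½ q<0
  halves : ∀ q → q * ½ + q * ½ ≡ q
  halves q = trans (sym (ℚ.*-distribˡ-+ q ½ ½)) (ℚ.*-identityʳ q)

-- The restriction to non-negative a and b makes 0 ·∞ ∞ equal to 0.
_·∞_ : [0,∞] ℓ → [0,∞] ℓ → [0,∞] ℓ
r ·∞ s = record
  { Below    = λ q → q < 0ℚ ⊎
      (∃[ a ] ∃[ b ] 0ℚ ≤ a × 0ℚ ≤ b × Below r a × Below s b × q < a * b)
  ; negative = λ q<0 → inj₁ q<0
  ; downward = λ { p<q (inj₁ q<0) → inj₁ (ℚ.<-trans p<q q<0)
                 ; p<q (inj₂ (a , b , 0≤a , 0≤b , ra , sb , q<ab)) →
                     inj₂ (a , b , 0≤a , 0≤b , ra , sb , ℚ.<-trans p<q q<ab) }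
  ; rounded  = λ { (inj₁ p<0) → let q , p<q , q<0 = ℚ.<-dense p<0 in
                                q , p<q , inj₁ q<0
                 ; (inj₂ (a , b , 0≤a , 0≤b , ra , sb , p<ab)) →
                     let q , p<q , q<ab = ℚ.<-dense p<ab in
                     q , p<q , inj₂ (a , b , 0≤a , 0≤b , ra , sb , q<ab) }
  }

∑ : (n : ℕ) → (Fin n → [0,∞] ℓ) → [0,∞] ℓ
∑ n r = Vector.foldr _+∞_ 0∞ {n} r

Finite : [0,∞] ℓ → Set ℓ
Finite r = ∃[ q ] ¬ Below r q

record Open (X : DCPO ℓ) : Set (lsuc ℓ) where
  private module X = DCPO X
  field
    Holds        : X.Carrier → Set ℓ
    upward       : ∀ {x y} → x X.⊑ y → Holds x → Holds y
    inaccessible : {I : Set ℓ} (d : I → X.Carrier) (dir : Directed X.poset d) →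
                   Holds (X.⋁ d dir) → ∃[ i ] Holds (d i)

infix 4 _∈_ _⊆_
infixr 6 _∪_
infixr 7 _∩_

_∈_ : {X : DCPO ℓ} → Carrier X → Open X → Set ℓ
x ∈ U = Open.Holds U x

record _⊆_ {X : DCPO ℓ} (U V : Open X) : Set (lsuc ℓ) where
  constructor ⊆-intro
  field ⊆-elim : ∀ {x} → x ∈ U → x ∈ V

open _⊆_ public

𝒪 : DCPO ℓ → DCPO ℓ
𝒪 X .DCPO.poset       = Interior.poset {R = _⊆_ {X = X}}
  (⊆-intro λ p → p) (λ p q → ⊆-intro λ m → ⊆-elim q (⊆-elim p m))
𝒪 X .DCPO.⋁ d _       = record
  { Holds        = λ x → ∃[ i ] x ∈ d i
  ; upward       = λ x⊑y (i , m) → i , Open.upward (d i) x⊑y m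
  ; inaccessible = λ e dir (i , m) →
      let j , m′ = Open.inaccessible (d i) e dir m in j , i , m′
  }
𝒪 X .DCPO.⋁-isLub d _ = record
  { upper = λ i → ⊆-intro λ m → i , m
  ; least = λ u ub → ⊆-intro λ (i , m) → ⊆-elim (ub i) m
  }

∅ : {X : DCPO ℓ} → Open X
∅ = record { Holds = λ _ → Empty.⊥ ; upward = λ _ () ; inaccessible = λ _ _ () }

_∪_ : {X : DCPO ℓ} → Open X → Open X → Open X
U ∪ V = record
  { Holds        = λ x → x ∈ U ⊎ x ∈ V
  ; upward       = λ { p (inj₁ m) → inj₁ (Open.upward U p m)
                     ; p (inj₂ m) → inj₂ (Open.upward V p m) }
  ; inaccessible = λ { d dir (inj₁ m) → let i , m′ = Open.inaccessible U d dir m in i , inj₁ m′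
                     ; d dir (inj₂ m) → let i , m′ = Open.inaccessible V d dir m in i , inj₂ m′ }
  }

_∩_ : {X : DCPO ℓ} → Open X → Open X → Open X
U ∩ V = record
  { Holds        = λ x → x ∈ U × x ∈ V
  ; upward       = λ p (m , n) → Open.upward U p m , Open.upward V p n
  ; inaccessible = λ d dir (m , n) → let
      i , m′    = Open.inaccessible U d dir m
      j , n′    = Open.inaccessible V d dir n
      k , p , q = Directed.bounded dir i j
    in k , Open.upward U p m′ , Open.upward V q n′
  }

_⁻¹]_,∞] : {X : DCPO ℓ} → X ⇒ 𝐑 → ℚ → Open X
h ⁻¹] t ,∞] = record
  { Holds        = λ x → Below (to h x) t
  ; upward       = λ p → ≤∞-elim (_⇒_.monotone h p)
  ; inaccessible = λ d dir → ≤∞-elim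
      (IsLub.least (_⇒_.continuous h d dir) (sup (Directed.inhabitant dir) (λ i → to h (d i)))
        (λ i → ≤∞-intro λ b → i , b))
  }

slice : (X Y : DCPO ℓ) → Open (X ⊗ Y) → Carrier X → Open Y
slice X Y W x = record
  { Holds        = λ y → (x , y) ∈ W
  ; upward       = λ p → Open.upward W (X.⊑-refl , p)
  ; inaccessible = λ d dir m → let
      dir′ = record { inhabitant = Directed.inhabitant dir
                    ; bounded    = λ i j → let k , p , q = Directed.bounded dir i j in
                                   k , (X.⊑-refl , p) , (X.⊑-refl , q) }
    in Open.inaccessible W (λ i → x , d i) dir′
         (Open.upward W
           ( IsLub.upper (X.⋁-isLub (λ _ → x) _) (Directed.inhabitant dir)
           , IsLub.least (Y.⋁-isLub d dir) _ (IsLub.upper (Y.⋁-isLub d _))) m)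
  }
  where
  module X = DCPO X
  module Y = DCPO Y

record Valuation (X : DCPO ℓ) : Set (lsuc ℓ) where
  open DCPO (𝐑 {ℓ}) using (_≈_)
  field
    measure : 𝒪 X ⇒ 𝐑
    strict  : to measure ∅ ≈ 0∞
    modular : ∀ U V → to measure (U ∪ V) +∞ to measure (U ∩ V) ≈ to measure U +∞ to measure V

infix 30 _⟪_⟫

_⟪_⟫ : {X : DCPO ℓ} → Valuation X → Open X → [0,∞] ℓ
ν ⟪ U ⟫ = to (Valuation.measure ν) U

record _≤ᵛ_ {X : DCPO ℓ} (μ ν : Valuation X) : Set (lsuc ℓ) where
  constructor ≤ᵛ-intro
  field ≤ᵛ-elim : ∀ U → μ ⟪ U ⟫ ≤∞ ν ⟪ U ⟫

open _≤ᵛ_ public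

valuations : DCPO ℓ → Poset (lsuc ℓ) (lsuc ℓ) (lsuc ℓ)
valuations X = Interior.poset {R = _≤ᵛ_ {X = X}}
  (≤ᵛ-intro λ U → ≤∞-intro λ b → b)
  (λ p q → ≤ᵛ-intro λ U → ≤∞-intro λ b → ≤∞-elim (≤ᵛ-elim q U) (≤∞-elim (≤ᵛ-elim p U) b))

module _ {X : DCPO ℓ} {I : Set ℓ} (d : I → Valuation X) (dir : Directed (valuations X) d) where
  private
    i₀ = Directed.inhabitant dir

    +-sup : ∀ U V {q} → Below (sup i₀ (λ i → d i ⟪ U ⟫) +∞ sup i₀ (λ i → d i ⟪ V ⟫)) q →
            ∃[ i ] Below (d i ⟪ U ⟫ +∞ d i ⟪ V ⟫) q
    +-sup U V (a , b , (i , x) , (j , y) , q≤a+b) =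
      let k , p , q = Directed.bounded dir i j in
      k , a , b , ≤∞-elim (≤ᵛ-elim p U) x , ≤∞-elim (≤ᵛ-elim q V) y , q≤a+b

    sup-+ : ∀ U V {q} → ∃[ i ] Below (d i ⟪ U ⟫ +∞ d i ⟪ V ⟫) q →
            Below (sup i₀ (λ i → d i ⟪ U ⟫) +∞ sup i₀ (λ i → d i ⟪ V ⟫)) q
    sup-+ U V (i , a , b , x , y , q≤a+b) = a , b , (i , x) , (i , y) , q≤a+b

  ⋁ᵛ : Valuation X
  ⋁ᵛ = record
    { measure = record
        { to         = λ U → sup i₀ (λ i → d i ⟪ U ⟫)
        ; monotone   = λ U⊆V → ≤∞-intro λ (i , b) →
            i , ≤∞-elim (_⇒_.monotone (Valuation.measure (d i)) U⊆V) b
        ; continuous = λ e dir′ → record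
            { upper = λ j → ≤∞-intro λ (i , b) →
                i , ≤∞-elim (IsLub.upper (_⇒_.continuous (Valuation.measure (d i)) e dir′) j) b
            ; least = λ u ub → ≤∞-intro λ (i , b) →
                ≤∞-elim (IsLub.least (_⇒_.continuous (Valuation.measure (d i)) e dir′) u
                  (λ j → ≤∞-intro λ b′ → ≤∞-elim (ub j) (i , b′))) b
            }
        }
    ; strict  =
        ≤∞-intro (λ (i , b) → ≤∞-elim (Interior.lhs≤rhs (Valuation.strict (d i))) b) Interior.,
        ≤∞-intro (λ b → i₀ , ≤∞-elim (Interior.rhs≤lhs (Valuation.strict (d i₀))) b)
    ; modular = λ U V →
        ≤∞-intro (λ b → let i , b′ = +-sup (U ∪ V) (U ∩ V) b in
          sup-+ U V (i , ≤∞-elim (Interior.lhs≤rhs (Valuation.modular (d i) U V)) b′)) Interior.,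
        ≤∞-intro (λ b → let i , b′ = +-sup U V b in
          sup-+ (U ∪ V) (U ∩ V) (i , ≤∞-elim (Interior.rhs≤lhs (Valuation.modular (d i) U V)) b′))
    }

  ⋁ᵛ-isLub : IsLub (valuations X) d ⋁ᵛ
  ⋁ᵛ-isLub = record
    { upper = λ i → ≤ᵛ-intro λ U → ≤∞-intro λ b → i , b
    ; least = λ u ub → ≤ᵛ-intro λ U → ≤∞-intro λ (i , b) → ≤∞-elim (≤ᵛ-elim (ub i) U) b
    }

𝐕 : DCPO ℓ → DCPO ℓ
𝐕 X .DCPO.poset   = valuations X
𝐕 X .DCPO.⋁       = ⋁ᵛ
𝐕 X .DCPO.⋁-isLub = ⋁ᵛ-isLub

-- Only the values of the Dirac valuation at x are needed below.
δ : {X : DCPO ℓ} → Carrier X → Open X → [0,∞] ℓ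
δ x U = [ x ∈ U ]

IsSimple : {X : DCPO ℓ} → Valuation X → Set (lsuc ℓ)
IsSimple {ℓ} {X} ν =
  Σ[ n ∈ ℕ ] Σ[ r ∈ (Fin n → [0,∞] ℓ) ] Σ[ x ∈ (Fin n → Carrier X) ]
    (∀ i → Finite (r i)) ×
    (∀ U → DCPO._≈_ 𝐑 (ν ⟪ U ⟫) (∑ n λ i → r i ·∞ δ (x i) U))

-- The smallest subset of 𝐕 X that contains the simple valuations and is
-- closed under the directed suprema of 𝐕 X; taking every least upper
-- bound ν of d, and not only the chosen one, makes it respect equality.
data IsMinimal {X : DCPO ℓ} : Valuation X → Set (lsuc ℓ) where
  simple : ∀ {ν} → IsSimple ν → IsMinimal ν
  lub    : {I : Set ℓ} (d : I → Valuation X) → Directed (DCPO.poset (𝐕 X)) d →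
           (∀ i → IsMinimal (d i)) → ∀ {ν} → IsLub (DCPO.poset (𝐕 X)) d ν → IsMinimal ν

record MinimalValuation (X : DCPO ℓ) : Set (lsuc ℓ) where
  field
    valuation : Valuation X
    isMinimal : IsMinimal valuation

open MinimalValuation public

record _≤ᵐ_ {X : DCPO ℓ} (μ ν : MinimalValuation X) : Set (lsuc ℓ) where
  constructor ≤ᵐ-intro
  field ≤ᵐ-elim : valuation μ ≤ᵛ valuation ν

open _≤ᵐ_ public

minimalValuations : DCPO ℓ → Poset (lsuc ℓ) (lsuc ℓ) (lsuc ℓ)
minimalValuations X = Interior.poset {R = _≤ᵐ_ {X = X}}
  (≤ᵐ-intro (DCPO.⊑-refl (𝐕 X)))
  (λ p q → ≤ᵐ-intro (DCPO.⊑-trans (𝐕 X) (≤ᵐ-elim p) (≤ᵐ-elim q)))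

private
  forget : {X : DCPO ℓ} {I : Set ℓ} {d : I → MinimalValuation X} →
           Directed (minimalValuations X) d → Directed (valuations X) (λ i → valuation (d i))
  forget dir = record
    { inhabitant = Directed.inhabitant dir
    ; bounded    = λ i j → let k , p , q = Directed.bounded dir i j in k , ≤ᵐ-elim p , ≤ᵐ-elim q
    }

𝐕ₘ : DCPO ℓ → DCPO ℓ
𝐕ₘ X .DCPO.poset         = minimalValuations X
𝐕ₘ X .DCPO.⋁ d dir       = record
  { valuation = DCPO.⋁ (𝐕 X) (λ i → valuation (d i)) (forget dir)
  ; isMinimal = lub (λ i → valuation (d i)) (forget dir) (λ i → isMinimal (d i))
                    (DCPO.⋁-isLub (𝐕 X) (λ i → valuation (d i)) (forget dir))
  }
𝐕ₘ X .DCPO.⋁-isLub d dir = record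
  { upper = λ i → ≤ᵐ-intro (IsLub.upper l i)
  ; least = λ u ub → ≤ᵐ-intro (IsLub.least l (valuation u) (λ i → ≤ᵐ-elim (ub i)))
  }
  where
  l = DCPO.⋁-isLub (𝐕 X) (λ i → valuation (d i)) (forget dir)

infix 30 _⟦_⟧

_⟦_⟧ : {X : DCPO ℓ} → MinimalValuation X → Open X → [0,∞] ℓ
ν ⟦ U ⟧ = valuation ν ⟪ U ⟫

evaluateAt : {X : DCPO ℓ} → Open X → 𝐕ₘ X ⇒ 𝐑
evaluateAt U = record
  { to         = λ ν → ν ⟦ U ⟧
  ; monotone   = λ p → ≤ᵛ-elim (≤ᵐ-elim p) U
  ; continuous = λ d dir → record
      { upper = λ i → ≤∞-intro λ b → i , b
      ; least = λ u ub → ≤∞-intro λ (i , b) → ≤∞-elim (ub i) b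
      }
  }

-- The Riemann integral over [0,∞[ of an antitone function f is the
-- supremum of its lower Darboux sums over all finite partitions
-- 0 = t₀ ≤ t₁ ≤ ... ≤ tₙ, where the infimum of f over [tᵢ , tᵢ₊₁] is f tᵢ₊₁.
-- A partition, starting at 0, is given by the widths tᵢ₊₁ - tᵢ of its
-- intervals; as f is antitone, rational widths suffice.

lowerSum : (ℚ → [0,∞] ℓ) → ℚ → List ℚ₊ → [0,∞] ℓ
lowerSum f t []       = 0∞
lowerSum f t (w ∷ ws) = fromℚ₊ w ·∞ f (t + proj₁ w) +∞ lowerSum f (t + proj₁ w) ws

riemannIntegral : (ℚ → [0,∞] ℓ) → [0,∞] ℓ
riemannIntegral {ℓ} f = sup {I = Lift ℓ (List ℚ₊)} (lift []) (λ ws → lowerSum f 0ℚ (lower ws))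

∫ : {X : DCPO ℓ} → (X ⇒ 𝐑) → Valuation X → [0,∞] ℓ
∫ h ν = riemannIntegral (λ t → ν ⟪ h ⁻¹] t ,∞] ⟫)

{-# OPTIONS --safe #-}

-- A Scott-continuous functional on minimal valuations that preserves finite
-- linear combinations is determined by its values on Dirac valuations.  For
-- fixed h, integration of h is such a functional: it is Scott-continuous in the
-- valuation because every lower Darboux sum is, additive because two partitions
-- have a common refinement, and its value at the Dirac valuation at x is h x.
-- Hence the modularity of f † μ and all the equations of a commutative monad
-- can be checked on Dirac valuations, where they are immediate; in the
-- commutativity law this is done in one argument after the other.  That f † μ
-- is again minimal follows by induction on the minimality of μ, minimal
-- valuations being closed under finite linear combinations.

module Submission where

open import Defs
open import Level using (Level; Lift; lift; lower) renaming (suc to lsuc)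
open import Algebra.Bundles using (CommutativeSemiring)
import Algebra.Properties.CommutativeSemigroup as CommutativeSemigroupProperties
open import Algebra.Structures.Biased using (isCommutativeMonoidˡ; isCommutativeSemiringˡ)
open import Data.Empty using (⊥-elim)
open import Data.Fin.Base using (Fin; zero; suc)
open import Data.List.Base using (List; []; _∷_)
open import Data.Nat.Base using (ℕ; zero; suc)
open import Data.Product.Base using (Σ-syntax; ∃-syntax; _×_; _,_; proj₁; proj₂)
open import Data.Rational.Base
  using (ℚ; 0ℚ; 1ℚ; _<_; _≤_; _+_; _*_; _-_; -_; 1/_; positive; nonNegative; NonZero; Positive)
import Data.Rational.Properties as ℚ
open import Data.Rational.Solver using (module +-*-Solver)
open import Data.Sum.Base using (_⊎_; inj₁; inj₂)
import Data.Unit.Polymorphic as Unit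
open import Relation.Binary.Bundles using (Poset)
open import Relation.Binary.Construct.Interior.Symmetric using (lhs≤rhs; rhs≤lhs) renaming (_,_ to _⇌_)
open import Relation.Binary.Definitions using (tri<; tri≈; tri>)
open import Relation.Binary.PropositionalEquality.Core using (_≡_; refl; cong; subst; subst₂)
  renaming (sym to ≡-sym; trans to ≡-trans)
import Relation.Binary.Reasoning.PartialOrder as ≤-Reasoning
open import Relation.Nullary.Decidable.Core using (yes; no)
open import Relation.Nullary.Negation.Core using (¬_)

open +-*-Solver using (solve; _:=_; _:+_; _:-_)

-- The obstacle is the exchange of two integrals. Minimality replaces an approximation of the open
-- set by an approximation of the valuation. This also decides which linearity of the integral is
-- studied. In the valuation it holds for each lower sum, because the superlevel sets of `h` stay
-- fixed; the superlevel sets of a sum of two integrands have no comparable decomposition. Extended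
-- reals are lower cuts without subtraction or decidable membership. An equation between them is
-- therefore a pair of inclusions with explicit rational witnesses, and the strict inequalities have
-- to leave enough room for these.

private variable
  ℓ : Level
  X Y : DCPO ℓ
  p q a b c : ℚ

-- The semiring of extended non-negative reals

split-< : ∀ u v → q < u + v → ∃[ x ] ∃[ y ] x < u × y < v × q ≤ x + y
split-< {q} u v q<u+v =
  -- The slack between `q` and `u + v` is divided at `m`: `u` is lowered by `u + v - m` and `v` by
  -- `m - q`, both of them positive.
  let m , q<m , m<u+v = ℚ.<-dense q<u+v in
  m - v , v + (q - m) ,
  subst (m - v <_) (solve 2 (λ u v → u :+ v :- v := u) refl u v) (ℚ.+-monoˡ-< (- v) m<u+v) ,
  subst₂ _<_ (solve 3 (λ q m v → q :+ (v :- m) := v :+ (q :- m)) refl q m v)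
    (solve 2 (λ m v → m :+ (v :- m) := v) refl m v) (ℚ.+-monoˡ-< (v - m) q<m) ,
  ℚ.≤-reflexive (solve 3 (λ q m v → q := m :- v :+ (v :+ (q :- m))) refl q m v)

*-mono-≤ˡ : 0ℚ ≤ a → b ≤ c → a * b ≤ a * c
*-mono-≤ˡ {a} 0≤a = ℚ.*-monoˡ-≤-nonNeg a {{nonNegative 0≤a}}

*-mono-≤ʳ : 0ℚ ≤ c → a ≤ b → a * c ≤ b * c
*-mono-≤ʳ {c} 0≤c = ℚ.*-monoʳ-≤-nonNeg c {{nonNegative 0≤c}}

0≤* : 0ℚ ≤ a → 0ℚ ≤ b → 0ℚ ≤ a * b
0≤* {a} {b} 0≤a 0≤b = subst (_≤ a * b) (ℚ.*-zeroʳ a) (*-mono-≤ˡ 0≤a 0≤b)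

-- For positive `a` the witness is a number between `q` and `a * c`, divided by `a`. For `a = 0`
-- both products vanish, and `c - 1ℚ` is just some number below `c`.
shrink-* : ∀ c → 0ℚ ≤ a → q < a * c → ∃[ c′ ] c′ < c × q < a * c′
shrink-* {a} {q} c 0≤a q<ac with ℚ.<-cmp 0ℚ a
... | tri> _ _ a<0 = ⊥-elim (ℚ.<-irrefl refl (ℚ.≤-<-trans 0≤a a<0))
... | tri≈ _ refl _ = c - 1ℚ ,
  subst (c - 1ℚ <_) (ℚ.+-identityʳ c) (ℚ.+-monoʳ-< c (ℚ.negative⁻¹ (- 1ℚ))) ,
  subst (q <_) (≡-trans (ℚ.*-zeroˡ c) (≡-sym (ℚ.*-zeroˡ (c - 1ℚ)))) q<ac
... | tri< 0<a _ _ =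
  let m , q<m , m<ac = ℚ.<-dense q<ac
      a⁻¹m≡m = ≡-trans (≡-sym (ℚ.*-assoc a (1/ a) m)) (≡-trans (cong (_* m) (ℚ.*-inverseʳ a)) (ℚ.*-identityˡ m))
  in 1/ a * m ,
     ℚ.*-cancelˡ-<-nonNeg a (subst (_< a * c) (≡-sym a⁻¹m≡m) m<ac) ,
     subst (q <_) (≡-sym a⁻¹m≡m) q<m
  where instance
    _ : Positive a
    _ = positive 0<a
    _ : NonZero a
    _ = ℚ.pos⇒nonZero a
    _ = ℚ.pos⇒nonNeg a

<⊎≤ : ∀ p q → p < q ⊎ q ≤ p
<⊎≤ p q with p ℚ.<? q
... | yes p<q = inj₁ p<q
... | no p≮q  = inj₂ (ℚ.≮⇒≥ p≮q)

+<0 : a < 0ℚ → b < 0ℚ → q ≤ a + b → q < 0ℚ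
+<0 a<0 b<0 q≤a+b = ℚ.≤-<-trans q≤a+b (ℚ.+-mono-< a<0 b<0)

below-≤ : (r : [0,∞] ℓ) → p ≤ q → Below r q → Below r p
below-≤ {p = p} {q} r p≤q rq with <⊎≤ p q
... | inj₁ p<q = [0,∞].downward r p<q rq
... | inj₂ q≤p = subst (Below r) (ℚ.≤-antisym q≤p p≤q) rq

0∞-least : (r : [0,∞] ℓ) → 0∞ ≤∞ r
0∞-least r = ≤∞-intro λ { (inj₁ q<0) → [0,∞].negative r q<0 }

-- The definition of `·∞` wants non-negative factors, but witnesses coming from sums or from
-- `shrink-*` may be negative. For negative `c` the bound `q < a * c ≤ 0` makes `q` negative, which
-- is the other clause of the definition.
below-· : (r s : [0,∞] ℓ) → 0ℚ ≤ a → Below r a → Below s c → q < a * c → Below (r ·∞ s) q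
below-· {a = a} {c} r s 0≤a ra sc q<ac with <⊎≤ c 0ℚ
... | inj₁ c<0 = inj₁ (ℚ.<-≤-trans q<ac (subst (a * c ≤_) (ℚ.*-zeroʳ a) (*-mono-≤ˡ 0≤a (ℚ.<⇒≤ c<0))))
... | inj₂ 0≤c = inj₂ (a , c , 0≤a , 0≤c , ra , sc , q<ac)

1∞ : [0,∞] ℓ
1∞ = [ Unit.⊤ ]

+∞-mono : {r r′ s s′ : [0,∞] ℓ} → r ≤∞ r′ → s ≤∞ s′ → r +∞ s ≤∞ r′ +∞ s′
+∞-mono p q = ≤∞-intro λ (a , b , ra , sb , q≤) → a , b , ≤∞-elim p ra , ≤∞-elim q sb , q≤

·∞-mono : {r r′ s s′ : [0,∞] ℓ} → r ≤∞ r′ → s ≤∞ s′ → r ·∞ s ≤∞ r′ ·∞ s′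
·∞-mono p q = ≤∞-intro λ
  { (inj₁ q<0) → inj₁ q<0
  ; (inj₂ (a , b , 0≤a , 0≤b , ra , sb , q<ab)) →
      inj₂ (a , b , 0≤a , 0≤b , ≤∞-elim p ra , ≤∞-elim q sb , q<ab) }

private
  +-comm-≤ : (r s : [0,∞] ℓ) → r +∞ s ≤∞ s +∞ r
  +-comm-≤ r s = ≤∞-intro λ (a , b , ra , sb , q≤a+b) →
    b , a , sb , ra , ℚ.≤-trans q≤a+b (ℚ.≤-reflexive (ℚ.+-comm a b))

  +-assoc-≤ : (r s t : [0,∞] ℓ) → r +∞ s +∞ t ≤∞ r +∞ (s +∞ t)
  +-assoc-≤ r s t = ≤∞-intro λ (x , c , (a , b , ra , sb , x≤a+b) , tc , q≤x+c) →
    a , b + c , ra , (b , c , sb , tc , ℚ.≤-refl) ,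
    ℚ.≤-trans q≤x+c (subst (x + c ≤_) (ℚ.+-assoc a b c) (ℚ.+-monoˡ-≤ c x≤a+b))

  +-assoc-≥ : (r s t : [0,∞] ℓ) → r +∞ (s +∞ t) ≤∞ r +∞ s +∞ t
  +-assoc-≥ r s t = ≤∞-intro λ (a , x , ra , (b , c , sb , tc , x≤b+c) , q≤a+x) →
    a + b , c , (a , b , ra , sb , ℚ.≤-refl) , tc ,
    ℚ.≤-trans q≤a+x (subst (a + x ≤_) (≡-sym (ℚ.+-assoc a b c)) (ℚ.+-monoʳ-≤ a x≤b+c))

  +-identityˡ-≤ : (r : [0,∞] ℓ) → 0∞ +∞ r ≤∞ r
  +-identityˡ-≤ r = ≤∞-intro λ
    { (a , b , inj₁ a<0 , rb , q≤a+b) →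
        below-≤ r (ℚ.≤-trans q≤a+b (subst (a + b ≤_) (ℚ.+-identityˡ b) (ℚ.+-monoˡ-≤ b (ℚ.<⇒≤ a<0)))) rb }

  +-identityˡ-≥ : (r : [0,∞] ℓ) → r ≤∞ 0∞ +∞ r
  +-identityˡ-≥ r = ≤∞-intro λ {q} rq → let q′ , q<q′ , rq′ = [0,∞].rounded r rq in
    q - q′ , q′ , inj₁ (subst (q - q′ <_) (ℚ.+-inverseʳ q′) (ℚ.+-monoˡ-< (- q′) q<q′)) , rq′ ,
    ℚ.≤-reflexive (solve 2 (λ q q′ → q := q :- q′ :+ q′) refl q q′)

  ·-comm-≤ : (r s : [0,∞] ℓ) → r ·∞ s ≤∞ s ·∞ r
  ·-comm-≤ r s = ≤∞-intro λ
    { (inj₁ q<0) → inj₁ q<0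
    ; (inj₂ (a , b , 0≤a , 0≤b , ra , sb , q<ab)) →
        inj₂ (b , a , 0≤b , 0≤a , sb , ra , subst (_ <_) (ℚ.*-comm a b) q<ab) }

  ·-assoc-≤ : (r s t : [0,∞] ℓ) → r ·∞ s ·∞ t ≤∞ r ·∞ (s ·∞ t)
  ·-assoc-≤ r s t = ≤∞-intro λ
    { (inj₁ q<0) → inj₁ q<0
    ; (inj₂ (x , c , 0≤x , 0≤c , inj₁ x<0 , tc , q<xc)) → ⊥-elim (ℚ.<-irrefl refl (ℚ.≤-<-trans 0≤x x<0))
    ; (inj₂ (x , c , 0≤x , 0≤c , inj₂ (a , b , 0≤a , 0≤b , ra , sb , x<ab) , tc , q<xc)) →
        -- Elements of `s ·∞ t` lie strictly below `b * c`, so `b * c` itself cannot serve as the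
        -- second factor.
        let d , d<bc , q<ad = shrink-* (b * c) 0≤a (ℚ.<-≤-trans q<xc
              (subst (x * c ≤_) (ℚ.*-assoc a b c) (*-mono-≤ʳ 0≤c (ℚ.<⇒≤ x<ab))))
        in below-· r (s ·∞ t) 0≤a ra (below-· s t 0≤b sb tc d<bc) q<ad }

  ·-identityˡ-≤ : (r : [0,∞] ℓ) → 1∞ ·∞ r ≤∞ r
  ·-identityˡ-≤ r = ≤∞-intro λ
    { (inj₁ q<0) → [0,∞].negative r q<0
    ; (inj₂ (a , b , 0≤a , 0≤b , a∈1 , rb , q<ab)) → [0,∞].downward r
        (ℚ.<-≤-trans q<ab (subst (a * b ≤_) (ℚ.*-identityˡ b) (*-mono-≤ʳ 0≤b (≤1 a∈1)))) rb }
    where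
    ≤1 : ∀ {a} → Below (1∞ {ℓ}) a → a ≤ 1ℚ
    ≤1 (inj₁ a<0)       = ℚ.<⇒≤ (ℚ.<-trans a<0 (ℚ.positive⁻¹ 1ℚ))
    ≤1 (inj₂ (_ , a<1)) = ℚ.<⇒≤ a<1

  ·-identityʳ-≥ : (r : [0,∞] ℓ) → r ≤∞ r ·∞ 1∞
  ·-identityʳ-≥ r = ≤∞-intro λ {q} rq → go rq (<⊎≤ q 0ℚ)
    where
    go : ∀ {q} → Below r q → q < 0ℚ ⊎ 0ℚ ≤ q → Below (r ·∞ 1∞) q
    go rq (inj₁ q<0) = inj₁ q<0
    go {q} rq (inj₂ 0≤q) =
      let q′ , q<q′ , rq′ = [0,∞].rounded r rq
          0≤q′            = ℚ.≤-trans 0≤q (ℚ.<⇒≤ q<q′)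
          c , c<1 , q<q′c = shrink-* 1ℚ 0≤q′ (subst (q <_) (≡-sym (ℚ.*-identityʳ q′)) q<q′)
      in below-· r 1∞ 0≤q′ rq′ (inj₂ (_ , c<1)) q<q′c

  ·-zeroˡ-≤ : (r : [0,∞] ℓ) → 0∞ ·∞ r ≤∞ 0∞
  ·-zeroˡ-≤ r = ≤∞-intro λ
    { (inj₁ q<0) → inj₁ q<0
    ; (inj₂ (a , b , 0≤a , 0≤b , inj₁ a<0 , rb , q<ab)) → ⊥-elim (ℚ.<-irrefl refl (ℚ.≤-<-trans 0≤a a<0)) }

  distribˡ-≤ : (r s t : [0,∞] ℓ) → r ·∞ (s +∞ t) ≤∞ r ·∞ s +∞ r ·∞ t
  distribˡ-≤ r s t = ≤∞-intro λ
    { (inj₁ q<0) → [0,∞].negative (r ·∞ s +∞ r ·∞ t) q<0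
    ; (inj₂ (a , x , 0≤a , 0≤x , ra , (b , c , sb , tc , x≤b+c) , q<ax)) →
        let y , z , y<ab , z<ac , q≤y+z = split-< (a * b) (a * c) (ℚ.<-≤-trans q<ax
              (subst (a * x ≤_) (ℚ.*-distribˡ-+ a b c) (*-mono-≤ˡ 0≤a x≤b+c)))
        in y , z , below-· r s 0≤a ra sb y<ab , below-· r t 0≤a ra tc z<ac , q≤y+z }

  -- t need not contain 0: lowering b slightly leaves room for a negative element of t.
  ·-below-left : (r s t : [0,∞] ℓ) → ∀ {y} → 0ℚ ≤ a → 0ℚ ≤ b → Below r a → Below s b → y < a * b →
                 q ≤ y → Below (r ·∞ (s +∞ t)) q
  ·-below-left {a = a} {b} r s t 0≤a 0≤b ra sb y<ab q≤y =
    let b′ , b′<b , q<ab′ = shrink-* b 0≤a (ℚ.≤-<-trans q≤y y<ab)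
    in below-· r (s +∞ t) 0≤a ra
         (b , b′ - b , sb , [0,∞].negative t (subst (b′ - b <_) (ℚ.+-inverseʳ b) (ℚ.+-monoˡ-< (- b) b′<b)) ,
          ℚ.≤-reflexive (solve 2 (λ b′ b → b′ := b :+ (b′ :- b)) refl b′ b))
         q<ab′

  distribˡ-≥ : (r s t : [0,∞] ℓ) → r ·∞ s +∞ r ·∞ t ≤∞ r ·∞ (s +∞ t)
  distribˡ-≥ r s t = ≤∞-intro λ
    { (y , z , inj₁ y<0 , inj₁ z<0 , q≤y+z) → inj₁ (+<0 y<0 z<0 q≤y+z)
    ; (y , z , inj₂ (a , b , 0≤a , 0≤b , ra , sb , y<ab) , inj₁ z<0 , q≤y+z) →
        ·-below-left r s t 0≤a 0≤b ra sb y<ab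
          (ℚ.≤-trans q≤y+z (subst (y + z ≤_) (ℚ.+-identityʳ y) (ℚ.+-monoʳ-≤ y (ℚ.<⇒≤ z<0))))
    ; (y , z , inj₁ y<0 , inj₂ (a , c , 0≤a , 0≤c , ra , tc , z<ac) , q≤y+z) →
        ≤∞-elim (·∞-mono {r = r} {r} (≤∞-intro λ x → x) (+-comm-≤ t s))
        (·-below-left r t s 0≤a 0≤c ra tc z<ac
          (ℚ.≤-trans q≤y+z (subst (y + z ≤_) (ℚ.+-identityˡ z) (ℚ.+-monoˡ-≤ z (ℚ.<⇒≤ y<0)))))
    ; (y , z , inj₂ (a , b , 0≤a , 0≤b , ra , sb , y<ab) , inj₂ (a′ , c , 0≤a′ , 0≤c , ra′ , tc , z<a′c) ,
       q≤y+z) →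
        combine 0≤a 0≤a′ 0≤b 0≤c ra ra′ sb tc y<ab z<a′c q≤y+z (ℚ.≤-total a a′) }
    where
    common : ∀ {a b c y z q} → 0ℚ ≤ a → 0ℚ ≤ b → 0ℚ ≤ c → Below r a → Below s b → Below t c →
             y < a * b → z < a * c → q ≤ y + z → Below (r ·∞ (s +∞ t)) q
    common {a} {b} {c} 0≤a 0≤b 0≤c ra sb tc y<ab z<ac q≤y+z =
      below-· r (s +∞ t) 0≤a ra (b , c , sb , tc , ℚ.≤-refl)
        (ℚ.≤-<-trans q≤y+z (subst (_ <_) (≡-sym (ℚ.*-distribˡ-+ a b c)) (ℚ.+-mono-< y<ab z<ac)))
    -- The two products may use different elements of `r`. The larger one can stand in for both, and
    -- it is then factored out.
    combine : ∀ {a a′ b c y z q} → 0ℚ ≤ a → 0ℚ ≤ a′ → 0ℚ ≤ b → 0ℚ ≤ c → Below r a → Below r a′ →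
              Below s b → Below t c → y < a * b → z < a′ * c → q ≤ y + z → a ≤ a′ ⊎ a′ ≤ a → Below (r ·∞ (s +∞ t)) q
    combine 0≤a 0≤a′ 0≤b 0≤c ra ra′ sb tc y< z< q≤ (inj₁ a≤a′) =
      common 0≤a′ 0≤b 0≤c ra′ sb tc (ℚ.<-≤-trans y< (*-mono-≤ʳ 0≤b a≤a′)) z< q≤
    combine 0≤a 0≤a′ 0≤b 0≤c ra ra′ sb tc y< z< q≤ (inj₂ a′≤a) =
      common 0≤a 0≤b 0≤c ra sb tc y< (ℚ.<-≤-trans z< (*-mono-≤ʳ 0≤c a′≤a)) q≤

[0,∞]-semiring : (ℓ : Level) → CommutativeSemiring (lsuc ℓ) (lsuc ℓ)
[0,∞]-semiring ℓ = record
  { _≈_ = _≈_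
  ; _+_ = _+∞_
  ; _*_ = _·∞_
  ; 0#  = 0∞
  ; 1#  = 1∞
  ; isCommutativeSemiring = isCommutativeSemiringˡ record
    { +-isCommutativeMonoid = isCommutativeMonoidˡ record
      { isSemigroup = record
        { isMagma = record { isEquivalence = isEquivalence
                           ; ∙-cong = λ (p ⇌ p′) (q ⇌ q′) → +∞-mono p q ⇌ +∞-mono p′ q′ }
        ; assoc = λ r s t → +-assoc-≤ r s t ⇌ +-assoc-≥ r s t }
      ; identityˡ = λ r → +-identityˡ-≤ r ⇌ +-identityˡ-≥ r
      ; comm = λ r s → +-comm-≤ r s ⇌ +-comm-≤ s r }
    ; *-isCommutativeMonoid = isCommutativeMonoidˡ record
      { isSemigroup = record
        { isMagma = record { isEquivalence = isEquivalence
                           ; ∙-cong = λ (p ⇌ p′) (q ⇌ q′) → ·∞-mono p q ⇌ ·∞-mono p′ q′ }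
        ; assoc = λ r s t → ·-assoc-≤ r s t ⇌
            -- The order of all three factors is reversed by commutativity, the inclusion already
            -- proved is applied with `r` and `t` exchanged, and the order is reversed again.
            trans (·-comm-≤ r (s ·∞ t)) (trans (·∞-mono (·-comm-≤ s t) refl≤)
              (trans (·-assoc-≤ t s r) (trans (·-comm-≤ t (s ·∞ r)) (·∞-mono (·-comm-≤ s r) refl≤)))) }
      ; identityˡ = λ r → ·-identityˡ-≤ r ⇌ trans (·-identityʳ-≥ r) (·-comm-≤ r 1∞)
      ; comm = λ r s → ·-comm-≤ r s ⇌ ·-comm-≤ s r }
    ; distribʳ = λ r s t →
        trans (·-comm-≤ (s +∞ t) r) (trans (distribˡ-≤ r s t) (+∞-mono (·-comm-≤ r s) (·-comm-≤ r t))) ⇌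
        trans (+∞-mono (·-comm-≤ s r) (·-comm-≤ t r)) (trans (distribˡ-≥ r s t) (·-comm-≤ r (s +∞ t)))
    ; zeroˡ = λ r → ·-zeroˡ-≤ r ⇌ 0∞-least _
    }
  }
  where open Poset (≤∞-poset ℓ) using (_≈_; trans; isEquivalence) renaming (refl to refl≤)

-- The laws are restated because conversion checking through the projections of
-- the bundle, which unfolds nested sums and products, is exponentially slow.
module R {ℓ : Level} where
  private
    module S = CommutativeSemiring ([0,∞]-semiring ℓ)
    module + = CommutativeSemigroupProperties S.+-commutativeSemigroup
    module · = CommutativeSemigroupProperties S.*-commutativeSemigroup

  open Poset (≤∞-poset ℓ) public using (_≈_)
  open Poset.Eq (≤∞-poset ℓ) public using (sym; trans) renaming (refl to ≈-refl)

  +-cong : {r r′ s s′ : [0,∞] ℓ} → r ≈ r′ → s ≈ s′ → r +∞ s ≈ r′ +∞ s′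
  +-cong = S.+-cong

  +-assoc : (r s t : [0,∞] ℓ) → r +∞ s +∞ t ≈ r +∞ (s +∞ t)
  +-assoc = S.+-assoc

  +-identityˡ : (r : [0,∞] ℓ) → 0∞ +∞ r ≈ r
  +-identityˡ = S.+-identityˡ

  +-identityʳ : (r : [0,∞] ℓ) → r +∞ 0∞ ≈ r
  +-identityʳ = S.+-identityʳ

  *-assoc : (r s t : [0,∞] ℓ) → r ·∞ s ·∞ t ≈ r ·∞ (s ·∞ t)
  *-assoc = S.*-assoc

  *-identityˡ : (r : [0,∞] ℓ) → 1∞ ·∞ r ≈ r
  *-identityˡ = S.*-identityˡ

  *-identityʳ : (r : [0,∞] ℓ) → r ·∞ 1∞ ≈ r
  *-identityʳ = S.*-identityʳ

  distribˡ : (r s t : [0,∞] ℓ) → r ·∞ (s +∞ t) ≈ r ·∞ s +∞ r ·∞ t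
  distribˡ = S.distribˡ

  distribʳ : (r s t : [0,∞] ℓ) → (s +∞ t) ·∞ r ≈ s ·∞ r +∞ t ·∞ r
  distribʳ = S.distribʳ

  zeroˡ : (r : [0,∞] ℓ) → 0∞ ·∞ r ≈ 0∞
  zeroˡ = S.zeroˡ

  zeroʳ : (r : [0,∞] ℓ) → r ·∞ 0∞ ≈ 0∞
  zeroʳ = S.zeroʳ

  interchange : (r s t u : [0,∞] ℓ) → r +∞ s +∞ (t +∞ u) ≈ r +∞ t +∞ (s +∞ u)
  interchange = +.interchange

  x∙yz≈y∙xz : (r s t : [0,∞] ℓ) → r ·∞ (s ·∞ t) ≈ s ·∞ (r ·∞ t)
  x∙yz≈y∙xz = ·.x∙yz≈y∙xz

  open Poset (≤∞-poset ℓ) public using () renaming (refl to ≤-refl; trans to ≤-trans)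

  +-monoˡ : ∀ t {r s : [0,∞] ℓ} → r ≤∞ s → r +∞ t ≤∞ s +∞ t
  +-monoˡ t r≤s = +∞-mono r≤s (≤-refl {t})

  +-monoʳ : ∀ t {r s : [0,∞] ℓ} → r ≤∞ s → t +∞ r ≤∞ t +∞ s
  +-monoʳ t r≤s = +∞-mono (≤-refl {t}) r≤s

  ·-monoˡ : ∀ t {r s : [0,∞] ℓ} → r ≤∞ s → r ·∞ t ≤∞ s ·∞ t
  ·-monoˡ t r≤s = ·∞-mono r≤s (≤-refl {t})

  ·-monoʳ : ∀ t {r s : [0,∞] ℓ} → r ≤∞ s → t ·∞ r ≤∞ t ·∞ s
  ·-monoʳ t r≤s = ·∞-mono (≤-refl {t}) r≤s

  +-congˡ : ∀ t {r s : [0,∞] ℓ} → r ≈ s → t +∞ r ≈ t +∞ s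
  +-congˡ t (r≤s ⇌ s≤r) = +-monoʳ t r≤s ⇌ +-monoʳ t s≤r

  +-congʳ : ∀ t {r s : [0,∞] ℓ} → r ≈ s → r +∞ t ≈ s +∞ t
  +-congʳ t (r≤s ⇌ s≤r) = +-monoˡ t r≤s ⇌ +-monoˡ t s≤r

  ·-congˡ : ∀ t {r s : [0,∞] ℓ} → r ≈ s → t ·∞ r ≈ t ·∞ s
  ·-congˡ t (r≤s ⇌ s≤r) = ·-monoʳ t r≤s ⇌ ·-monoʳ t s≤r

-- Scott-continuous maps into the extended reals

below-⋁ : {X : DCPO ℓ} (F : X ⇒ 𝐑) {I : Set ℓ} (d : I → DCPO.Carrier X) (dir : Directed (DCPO.poset X) d) →
          Below (to F (DCPO.⋁ X d dir)) q → ∃[ i ] Below (to F (d i)) q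
below-⋁ {q = q} F = Open.inaccessible (F ⁻¹] q ,∞])

-- Suprema in `𝐑` are unions of the sets `Below`, so continuity reduces to a membership condition: a
-- rational below the value at a supremum is already below the value at some member.
into-𝐑 : {X : DCPO ℓ} (f : DCPO.Carrier X → [0,∞] ℓ) →
         (∀ {x y} → DCPO._⊑_ X x y → f x ≤∞ f y) →
         (∀ {q} {I : Set ℓ} (d : I → DCPO.Carrier X) (dir : Directed (DCPO.poset X) d) →
            Below (f (DCPO.⋁ X d dir)) q → ∃[ i ] Below (f (d i)) q) →
         X ⇒ 𝐑
into-𝐑 {X = X} f mono inaccessible = record
  { to         = f
  ; monotone   = mono
  ; continuous = λ d dir → record
      { upper = λ i → mono (IsLub.upper (DCPO.⋁-isLub X d dir) i)
      ; least = λ u ub → ≤∞-intro λ b → let i , b′ = inaccessible d dir b in ≤∞-elim (ub i) b′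
      }
  }

const-𝐑 : {X : DCPO ℓ} → [0,∞] ℓ → X ⇒ 𝐑
const-𝐑 r = into-𝐑 (λ _ → r) (λ _ → R.≤-refl) (λ d dir b → Directed.inhabitant dir , b)

infixl 6 _+⇒_
infixl 7 _·⇒_

_+⇒_ : X ⇒ 𝐑 → X ⇒ 𝐑 → X ⇒ 𝐑
F +⇒ G = into-𝐑 (λ x → to F x +∞ to G x) (λ p → +∞-mono (_⇒_.monotone F p) (_⇒_.monotone G p))
  λ d dir (a , b , Fa , Gb , q≤a+b) → let
    i , Fa′   = below-⋁ F d dir Fa
    j , Gb′   = below-⋁ G d dir Gb
    k , p , q = Directed.bounded dir i j
  in k , a , b , ≤∞-elim (_⇒_.monotone F p) Fa′ , ≤∞-elim (_⇒_.monotone G q) Gb′ , q≤a+b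

_·⇒_ : {X : DCPO ℓ} → [0,∞] ℓ → X ⇒ 𝐑 → X ⇒ 𝐑
r ·⇒ F = into-𝐑 (λ x → r ·∞ to F x) (λ p → R.·-monoʳ r (_⇒_.monotone F p)) λ
  { d dir (inj₁ q<0) → Directed.inhabitant dir , inj₁ q<0
  ; d dir (inj₂ (a , b , 0≤a , 0≤b , ra , Fb , q<ab)) →
      let i , Fb′ = below-⋁ F d dir Fb in i , inj₂ (a , b , 0≤a , 0≤b , ra , Fb′ , q<ab) }

-- The Riemann integral

lowerSum-mono : {f g : ℚ → [0,∞] ℓ} → (∀ s → f s ≤∞ g s) → ∀ t ws → lowerSum f t ws ≤∞ lowerSum g t ws
lowerSum-mono f≤g t []       = R.≤-refl
lowerSum-mono f≤g t (w ∷ ws) = +∞-mono (R.·-monoʳ (fromℚ₊ w) (f≤g (t + proj₁ w)))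
  (lowerSum-mono f≤g (t + proj₁ w) ws)

riemannIntegral-mono : {f g : ℚ → [0,∞] ℓ} → (∀ s → f s ≤∞ g s) → riemannIntegral f ≤∞ riemannIntegral g
riemannIntegral-mono f≤g = ≤∞-intro λ (lift ws , b) → lift ws , ≤∞-elim (lowerSum-mono f≤g _ ws) b

riemannIntegral-cong : {f g : ℚ → [0,∞] ℓ} → (∀ s → f s R.≈ g s) → riemannIntegral f R.≈ riemannIntegral g
riemannIntegral-cong f≈g =
  riemannIntegral-mono (λ s → lhs≤rhs (f≈g s)) ⇌ riemannIntegral-mono (λ s → rhs≤lhs (f≈g s))

-- Mutual with `lowerSum-⋁`: the continuity for `w ∷ ws` is that of a sum of morphisms, one of which
-- is `lowerSum⇒` for the tail `ws`.
lowerSum⇒ : (ℚ → X ⇒ 𝐑) → ℚ → List ℚ₊ → X ⇒ 𝐑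
lowerSum-⋁ : {X : DCPO ℓ} (F : ℚ → X ⇒ 𝐑) (t : ℚ) (ws : List ℚ₊) →
             ∀ {q} {I : Set ℓ} (d : I → DCPO.Carrier X) (dir : Directed (DCPO.poset X) d) →
             Below (lowerSum (λ s → to (F s) (DCPO.⋁ X d dir)) t ws) q →
             ∃[ i ] Below (lowerSum (λ s → to (F s) (d i)) t ws) q

lowerSum⇒ F t ws = into-𝐑 (λ x → lowerSum (λ s → to (F s) x) t ws)
  (λ p → lowerSum-mono (λ s → _⇒_.monotone (F s) p) t ws) (lowerSum-⋁ F t ws)

lowerSum-⋁ F t []       d dir b = Directed.inhabitant dir , b
lowerSum-⋁ F t (w ∷ ws) d dir b = below-⋁ (fromℚ₊ w ·⇒ F (t + proj₁ w) +⇒ lowerSum⇒ F (t + proj₁ w) ws) d dir b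

riemannIntegral⇒ : (ℚ → X ⇒ 𝐑) → X ⇒ 𝐑
riemannIntegral⇒ F = into-𝐑 (λ x → riemannIntegral (λ s → to (F s) x))
  (λ p → riemannIntegral-mono (λ s → _⇒_.monotone (F s) p))
  λ d dir (lift ws , b) → let i , b′ = lowerSum-⋁ F 0ℚ ws d dir b in i , lift ws , b′

Antitone : (ℚ → [0,∞] ℓ) → Set (lsuc ℓ)
Antitone f = ∀ {s t} → s ≤ t → f t ≤∞ f s

module _ {ℓ : Level} where
  private
    -- Refinement is taken by its effect on lower sums, for all antitone functions and all starting
    -- points at once. One refinement then serves two functions, and the relation is kept when a
    -- width is prefixed.
    _≼_ : List ℚ₊ → List ℚ₊ → Set (lsuc ℓ)
    us ≼ vs = (f : ℚ → [0,∞] ℓ) → Antitone f → ∀ t → lowerSum f t us ≤∞ lowerSum f t vs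

    ∷-mono : ∀ w {us vs} → us ≼ vs → (w ∷ us) ≼ (w ∷ vs)
    ∷-mono w us≼vs f anti t = R.+-monoʳ (fromℚ₊ w ·∞ f (t + proj₁ w)) (us≼vs f anti (t + proj₁ w))

    ≼-refl : ∀ us → us ≼ us
    ≼-refl us f anti t = R.≤-refl

    []≼ : ∀ us → [] ≼ us
    []≼ us f anti t = 0∞-least (lowerSum f t us)

    ≼-trans : ∀ us vs ws → us ≼ vs → vs ≼ ws → us ≼ ws
    ≼-trans us vs ws us≼vs vs≼ws f anti t = R.≤-trans (us≼vs f anti t) (vs≼ws f anti t)

    fromℚ₊-+ : ∀ u v w → proj₁ u ≡ proj₁ v + proj₁ w → fromℚ₊ {ℓ} u ≤∞ fromℚ₊ v +∞ fromℚ₊ w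
    fromℚ₊-+ u v w u≡v+w = ≤∞-intro λ (lift q<u) →
      let x , y , x<v , y<w , q≤x+y = split-< (proj₁ v) (proj₁ w) (subst (_ <_) u≡v+w q<u)
      in x , y , lift x<v , lift y<w , q≤x+y

    -- The rectangle of width `u` and height `f s₂` is cut vertically at `s₁`; the left piece may
    -- then grow to the height `f s₁`, as `f` is antitone.
    subdivide : ∀ u v w us → proj₁ u ≡ proj₁ v + proj₁ w → (u ∷ us) ≼ (v ∷ w ∷ us)
    subdivide u v w us u≡v+w f anti t = begin
      fromℚ₊ u ·∞ f (t + proj₁ u) +∞ lowerSum f (t + proj₁ u) us
        ≡⟨ cong (λ s → fromℚ₊ u ·∞ f s +∞ lowerSum f s us)
             (≡-trans (cong (t +_) u≡v+w) (≡-sym (ℚ.+-assoc t (proj₁ v) (proj₁ w)))) ⟩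
      fromℚ₊ u ·∞ f s₂ +∞ L
        ≤⟨ R.+-monoˡ L (R.·-monoˡ (f s₂) (fromℚ₊-+ u v w u≡v+w)) ⟩
      (fromℚ₊ v +∞ fromℚ₊ w) ·∞ f s₂ +∞ L
        ≈⟨ R.+-congʳ L (R.distribʳ (f s₂) (fromℚ₊ v) (fromℚ₊ w)) ⟩
      fromℚ₊ v ·∞ f s₂ +∞ fromℚ₊ w ·∞ f s₂ +∞ L
        ≈⟨ R.+-assoc (fromℚ₊ v ·∞ f s₂) (fromℚ₊ w ·∞ f s₂) L ⟩
      fromℚ₊ v ·∞ f s₂ +∞ (fromℚ₊ w ·∞ f s₂ +∞ L)
        ≤⟨ R.+-monoˡ (fromℚ₊ w ·∞ f s₂ +∞ L) (R.·-monoʳ (fromℚ₊ v) (anti s₁≤s₂)) ⟩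
      fromℚ₊ v ·∞ f s₁ +∞ (fromℚ₊ w ·∞ f s₂ +∞ L) ∎
      where
      open ≤-Reasoning (≤∞-poset ℓ)
      s₁ = t + proj₁ v
      s₂ = t + proj₁ v + proj₁ w
      L  = lowerSum f s₂ us
      s₁≤s₂ : s₁ ≤ s₂
      s₁≤s₂ = subst (_≤ s₂) (ℚ.+-identityʳ s₁) (ℚ.+-monoʳ-≤ s₁ (proj₂ w))

    0≤- : ∀ {a b} → a ≤ b → 0ℚ ≤ b - a
    0≤- {a} {b} a≤b = subst (_≤ b - a) (ℚ.+-inverseʳ a) (ℚ.+-monoˡ-≤ (- a) a≤b)

    _∸_⟨_⟩ : ∀ (v u : ℚ₊) → proj₁ u ≤ proj₁ v → Σ[ w ∈ ℚ₊ ] proj₁ v ≡ proj₁ u + proj₁ w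
    v ∸ u ⟨ u≤v ⟩ =
      (proj₁ v - proj₁ u , 0≤- u≤v) ,
      solve 2 (λ u v → v := u :+ (v :- u)) refl (proj₁ u) (proj₁ v)

    -- This merges the two sequences of partition points: the shorter first interval is split off
    -- the longer one, whose remainder stays at the head of its list. Each step shortens one list
    -- and keeps the length of the other; `go` takes the head `u` as an argument because the
    -- remainder may replace it while `us` is unchanged.
    common-refinement : ∀ us vs → ∃[ ws ] us ≼ ws × vs ≼ ws
    common-refinement []       vs = vs , []≼ vs , ≼-refl vs
    common-refinement (u ∷ us) vs = go u vs
      where
      go : ∀ u vs → ∃[ ws ] (u ∷ us) ≼ ws × vs ≼ ws
      go u []       = u ∷ us , ≼-refl (u ∷ us) , []≼ (u ∷ us)
      go u (v ∷ vs) with ℚ.≤-total (proj₁ u) (proj₁ v)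
      ... | inj₁ u≤v =
        let w , v≡u+w  = v ∸ u ⟨ u≤v ⟩
            ws , p , q = common-refinement us (w ∷ vs)
        in u ∷ ws , ∷-mono u {us} {ws} p ,
           ≼-trans (v ∷ vs) (u ∷ w ∷ vs) (u ∷ ws) (subdivide v u w vs v≡u+w) (∷-mono u {w ∷ vs} {ws} q)
      ... | inj₂ v≤u =
        let w , u≡v+w  = u ∸ v ⟨ v≤u ⟩
            ws , p , q = go w vs
        in v ∷ ws ,
           ≼-trans (u ∷ us) (v ∷ w ∷ us) (v ∷ ws) (subdivide u v w us u≡v+w) (∷-mono v {w ∷ us} {ws} p) ,
           ∷-mono v {vs} {ws} q

  lowerSum-+ : ∀ (f g : ℚ → [0,∞] ℓ) t ws →
               lowerSum (λ s → f s +∞ g s) t ws R.≈ lowerSum f t ws +∞ lowerSum g t ws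
  lowerSum-+ f g t []       = R.sym (R.+-identityˡ 0∞)
  lowerSum-+ f g t (w ∷ ws) = R.trans
    (R.+-cong (R.distribˡ (fromℚ₊ w) (f s) (g s)) (lowerSum-+ f g s ws))
    (R.interchange (fromℚ₊ w ·∞ f s) (fromℚ₊ w ·∞ g s) (lowerSum f s ws) (lowerSum g s ws))
    where s = t + proj₁ w

  lowerSum-· : ∀ r (f : ℚ → [0,∞] ℓ) t ws → lowerSum (λ s → r ·∞ f s) t ws R.≈ r ·∞ lowerSum f t ws
  lowerSum-· r f t []       = R.sym (R.zeroʳ r)
  lowerSum-· r f t (w ∷ ws) = R.trans
    (R.+-cong (R.x∙yz≈y∙xz (fromℚ₊ w) r (f s)) (lowerSum-· r f s ws))
    (R.sym (R.distribˡ r (fromℚ₊ w ·∞ f s) (lowerSum f s ws)))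
    where s = t + proj₁ w

  lowerSum≤riemannIntegral : ∀ (f : ℚ → [0,∞] ℓ) ws → lowerSum f 0ℚ ws ≤∞ riemannIntegral f
  lowerSum≤riemannIntegral f ws = ≤∞-intro λ b → lift ws , b

  riemannIntegral-+ : {f g : ℚ → [0,∞] ℓ} → Antitone f → Antitone g →
                      riemannIntegral (λ s → f s +∞ g s) R.≈ riemannIntegral f +∞ riemannIntegral g
  riemannIntegral-+ {f} {g} f-anti g-anti =
    ≤∞-intro (λ (lift ws , b) →
      ≤∞-elim (+∞-mono (lowerSum≤riemannIntegral f ws) (lowerSum≤riemannIntegral g ws))
        (≤∞-elim (lhs≤rhs (lowerSum-+ f g 0ℚ ws)) b)) ⇌
    ≤∞-intro (λ (a , b , (lift us , fa) , (lift vs , gb) , q≤a+b) →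
      let ws , us≼ws , vs≼ws = common-refinement us vs in
      lift ws , ≤∞-elim (rhs≤lhs (lowerSum-+ f g 0ℚ ws))
        (a , b , ≤∞-elim (us≼ws f f-anti 0ℚ) fa , ≤∞-elim (vs≼ws g g-anti 0ℚ) gb , q≤a+b))

  riemannIntegral-· : ∀ r (f : ℚ → [0,∞] ℓ) → riemannIntegral (λ s → r ·∞ f s) R.≈ r ·∞ riemannIntegral f
  riemannIntegral-· r f =
    ≤∞-intro (λ (lift ws , b) →
      ≤∞-elim (R.·-monoʳ r (lowerSum≤riemannIntegral f ws))
        (≤∞-elim (lhs≤rhs (lowerSum-· r f 0ℚ ws)) b)) ⇌
    ≤∞-intro λ
      { (inj₁ q<0) → [0,∞].negative (riemannIntegral (λ s → r ·∞ f s)) q<0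
      ; (inj₂ (a , b , 0≤a , 0≤b , ra , (lift ws , fb) , q<ab)) →
          lift ws , ≤∞-elim (rhs≤lhs (lowerSum-· r f 0ℚ ws)) (inj₂ (a , b , 0≤a , 0≤b , ra , fb , q<ab)) }

  riemannIntegral-0 : riemannIntegral (λ _ → 0∞) R.≈ 0∞ {ℓ}
  -- The integrand `0∞` is rewritten as `0∞ ·∞ 0∞`, so that homogeneity applies.
  riemannIntegral-0 = R.trans (riemannIntegral-cong (λ _ → R.sym (R.zeroˡ 0∞)))
    (R.trans (riemannIntegral-· 0∞ (λ _ → 0∞)) (R.zeroˡ (riemannIntegral (λ _ → 0∞))))

  -- The lower sums starting at `t` are bounded by the maximum of 0 and `r - t`, the length of the
  -- part of `[t, ∞[` below `r`; the disjunction expresses this without subtraction. An interval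
  -- contributes at most its width `w`, and more than 0 only if its right end `t + w` is still below
  -- `r`.
  lowerSum-levels : ∀ (r : [0,∞] ℓ) t ws → Below (lowerSum (λ s → [ Below r s ]) t ws) q →
                    q < 0ℚ ⊎ Below r (t + q)
  lowerSum-levels r t [] (inj₁ q<0) = inj₁ q<0
  lowerSum-levels {q = q} r t ((w , 0≤w) ∷ ws) (a , b , wa , Lb , q≤a+b) =
    go (≤w wa) (lowerSum-levels r (t + w) ws Lb)
    where
    ≤w : Below (fromℚ₊ (w , 0≤w) ·∞ [ Below r (t + w) ]) a → a < 0ℚ ⊎ (Below r (t + w) × a ≤ w)
    ≤w (inj₁ a<0) = inj₁ a<0
    ≤w (inj₂ (c , d , 0≤c , 0≤d , _ , inj₁ d<0 , _)) = ⊥-elim (ℚ.<-irrefl refl (ℚ.≤-<-trans 0≤d d<0))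
    ≤w (inj₂ (c , d , 0≤c , 0≤d , lift c<w , inj₂ (rw , d<1) , a<cd)) = inj₂ (rw ,
      ℚ.<⇒≤ (ℚ.<-trans (ℚ.<-≤-trans a<cd (subst (c * d ≤_) (ℚ.*-identityʳ c) (*-mono-≤ˡ 0≤c (ℚ.<⇒≤ d<1)))) c<w))

    go : a < 0ℚ ⊎ (Below r (t + w) × a ≤ w) → b < 0ℚ ⊎ Below r (t + w + b) → q < 0ℚ ⊎ Below r (t + q)
    go (inj₁ a<0)        (inj₁ b<0) = inj₁ (+<0 a<0 b<0 q≤a+b)
    go (inj₂ (rw , a≤w)) (inj₁ b<0) = inj₂ (below-≤ r (ℚ.+-monoʳ-≤ t
      (ℚ.≤-trans q≤a+b (subst (a + b ≤_) (ℚ.+-identityʳ w) (ℚ.+-mono-≤ a≤w (ℚ.<⇒≤ b<0))))) rw)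
    -- Here the tail already reaches beyond `t + w`, and in either case the first interval
    -- contributes at most `w`.
    go a? (inj₂ rwb) = inj₂ (below-≤ r (subst (t + q ≤_) (≡-sym (ℚ.+-assoc t w b))
      (ℚ.+-monoʳ-≤ t (ℚ.≤-trans q≤a+b (ℚ.+-monoˡ-≤ b (a≤w a?))))) rwb)
      where
      a≤w : a < 0ℚ ⊎ (Below r (t + w) × a ≤ w) → a ≤ w
      a≤w (inj₁ a<0)       = ℚ.≤-trans (ℚ.<⇒≤ a<0) 0≤w
      a≤w (inj₂ (_ , a≤w)) = a≤w

  riemannIntegral-levels : (r : [0,∞] ℓ) → riemannIntegral (λ t → [ Below r t ]) R.≈ r
  riemannIntegral-levels r = ≤∞-intro (λ (lift ws , b) → below (lowerSum-levels r 0ℚ ws b)) ⇌ ≤∞-intro above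
    where
    below : ∀ {q} → q < 0ℚ ⊎ Below r (0ℚ + q) → Below r q
    below (inj₁ q<0)     = [0,∞].negative r q<0
    below {q} (inj₂ r0q) = subst (Below r) (ℚ.+-identityˡ q) r0q

    above : ∀ {q} → Below r q → Below (riemannIntegral (λ t → [ Below r t ])) q
    above {q} rq with <⊎≤ q 0ℚ
    ... | inj₁ q<0 = [0,∞].negative (riemannIntegral (λ t → [ Below r t ])) q<0
    ... | inj₂ 0≤q =
      -- A single interval from 0 to `w` suffices: `w` is still below `r`, so the indicator at the
      -- right end is 1, and `q < w` gives the strict inequality.
      let w , q<w , rw = [0,∞].rounded r rq
          w₊ = w , ℚ.≤-trans 0≤q (ℚ.<⇒≤ q<w)
      in lift (w₊ ∷ []) ,
         ≤∞-elim (rhs≤lhs (R.+-identityʳ (fromℚ₊ w₊ ·∞ [ Below r (0ℚ + w) ])))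
           (≤∞-elim (R.·-monoʳ (fromℚ₊ w₊) {r = 1∞} {s = [ Below r (0ℚ + w) ]} (≤∞-intro
               λ { (inj₁ p<0) → inj₁ p<0
                 ; (inj₂ (_ , p<1)) → inj₂ (subst (Below r) (≡-sym (ℚ.+-identityˡ w)) rw , p<1) }))
             (≤∞-elim (rhs≤lhs (R.*-identityʳ (fromℚ₊ w₊))) (lift q<w)))

-- Morphisms and valuations

resp-≈ : (f : X ⇒ Y) {x y : DCPO.Carrier X} → DCPO._≈_ X x y → DCPO._≈_ Y (to f x) (to f y)
resp-≈ {X = X} {Y = Y} f x≈y = DCPO.⊑-antisym Y
  (_⇒_.monotone f (DCPO.⊑-reflexive X x≈y)) (_⇒_.monotone f (DCPO.⊑-reflexive X (DCPO.≈.sym X x≈y)))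

-- The field `continuous` speaks of the chosen supremum, whereas the constructor `lub` of
-- `IsMinimal` admits every least upper bound.
preserves-lub : {X Y : DCPO ℓ} (f : X ⇒ Y) {I : Set ℓ} {d : I → DCPO.Carrier X} → Directed (DCPO.poset X) d →
                ∀ {s} → IsLub (DCPO.poset X) d s → IsLub (DCPO.poset Y) (λ i → to f (d i)) (to f s)
preserves-lub {X = X} {Y} f {d = d} dir {s} isLub = record
  { upper = λ i → _⇒_.monotone f (IsLub.upper isLub i)
  ; least = λ u ub → DCPO.⊑-trans Y
      (_⇒_.monotone f (IsLub.least isLub _ (IsLub.upper (DCPO.⋁-isLub X d dir))))
      (IsLub.least (_⇒_.continuous f d dir) u ub)
  }

map-directed : {X Y : DCPO ℓ} (f : X ⇒ Y) {I : Set ℓ} {d : I → DCPO.Carrier X} →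
               Directed (DCPO.poset X) d → Directed (DCPO.poset Y) (λ i → to f (d i))
map-directed f dir = record
  { inhabitant = Directed.inhabitant dir
  ; bounded    = λ i j → let k , p , q = Directed.bounded dir i j in
                 k , _⇒_.monotone f p , _⇒_.monotone f q
  }

infix 4 _≈ᵐ_
_≈ᵐ_ : {X : DCPO ℓ} → MinimalValuation X → MinimalValuation X → Set (lsuc ℓ)
_≈ᵐ_ {X = X} = DCPO._≈_ (𝐕ₘ X)

≈ᵐ-intro : {μ ν : MinimalValuation X} → (∀ U → μ ⟦ U ⟧ R.≈ ν ⟦ U ⟧) → μ ≈ᵐ ν
≈ᵐ-intro μ≈ν = ≤ᵐ-intro (≤ᵛ-intro λ U → lhs≤rhs (μ≈ν U)) ⇌ ≤ᵐ-intro (≤ᵛ-intro λ U → rhs≤lhs (μ≈ν U))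

≈ᵐ-elim : {μ ν : MinimalValuation X} → μ ≈ᵐ ν → ∀ U → μ ⟦ U ⟧ R.≈ ν ⟦ U ⟧
≈ᵐ-elim (p ⇌ q) U = ≤ᵛ-elim (≤ᵐ-elim p) U ⇌ ≤ᵛ-elim (≤ᵐ-elim q) U

-- Order and suprema of valuations are determined at each open set, so continuity is inherited from
-- the evaluations. These are passed separately as `F` because the values of the opaque valuations
-- are accessible only up to `≈`.
into-𝐕 : {Y Z : DCPO ℓ} (Φ : DCPO.Carrier Z → Valuation Y) (F : Open Y → Z ⇒ 𝐑) →
         (∀ U z → Φ z ⟪ U ⟫ R.≈ to (F U) z) → Z ⇒ 𝐕 Y
into-𝐕 {Y = Y} {Z} Φ F Φ≈F = record
  { to         = Φ
  ; monotone   = mono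
  ; continuous = λ d dir → record
      { upper = λ i → mono (IsLub.upper (DCPO.⋁-isLub Z d dir) i)
      ; least = λ u ub → ≤ᵛ-intro λ U → R.≤-trans (lhs≤rhs (Φ≈F U (DCPO.⋁ Z d dir)))
          (IsLub.least (_⇒_.continuous (F U) d dir) (u ⟪ U ⟫) λ i →
            R.≤-trans (rhs≤lhs (Φ≈F U (d i))) (≤ᵛ-elim (ub i) U))
      }
  }
  where
  mono : ∀ {x y} → DCPO._⊑_ Z x y → Φ x ≤ᵛ Φ y
  mono {x} {y} p = ≤ᵛ-intro λ U →
    R.≤-trans (lhs≤rhs (Φ≈F U x)) (R.≤-trans (_⇒_.monotone (F U) p) (rhs≤lhs (Φ≈F U y)))

into-𝐕ₘ : {Y Z : DCPO ℓ} (Φ : DCPO.Carrier Z → MinimalValuation Y) (F : Open Y → Z ⇒ 𝐑) →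
          (∀ U z → Φ z ⟦ U ⟧ R.≈ to (F U) z) → Z ⇒ 𝐕ₘ Y
into-𝐕ₘ {Y = Y} {Z} Φ F Φ≈F = record
  { to         = Φ
  ; monotone   = λ p → ≤ᵐ-intro (_⇒_.monotone Φᵛ p)
  ; continuous = λ d dir → let isLub = _⇒_.continuous Φᵛ d dir in record
      { upper = λ i → ≤ᵐ-intro (IsLub.upper isLub i)
      ; least = λ u ub → ≤ᵐ-intro (IsLub.least isLub (valuation u) (λ i → ≤ᵐ-elim (ub i)))
      }
  }
  where
  Φᵛ : Z ⇒ 𝐕 Y
  Φᵛ = into-𝐕 (λ z → valuation (Φ z)) F Φ≈F

[]-mono : {A B : Set ℓ} → (A → B) → [ A ] ≤∞ [ B ]
[]-mono f = ≤∞-intro λ { (inj₁ q<0) → inj₁ q<0 ; (inj₂ (a , q<1)) → inj₂ (f a , q<1) }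

-- The cases are distinguished on the witnesses of the two summands, so neither `A` nor `B` has to
-- be decided. When only `B` is witnessed, and by the first summand of one side, the two summands
-- change places.
[]-modular : (A B : Set ℓ) → [ A ⊎ B ] +∞ [ A × B ] R.≈ [ A ] +∞ [ B ]
[]-modular A B = ≤∞-intro to-sum ⇌ ≤∞-intro from-sum
  where
  to-sum : Below ([ A ⊎ B ] +∞ [ A × B ]) q → Below ([ A ] +∞ [ B ]) q
  to-sum (a , b , a∈ , inj₂ ((x , y) , b<1) , q≤a+b) = a , b , weaken a∈ , inj₂ (y , b<1) , q≤a+b
    where
    weaken : ∀ {a} → Below [ A ⊎ B ] a → Below [ A ] a
    weaken (inj₁ a<0)       = inj₁ a<0
    weaken (inj₂ (_ , a<1)) = inj₂ (x , a<1)
  to-sum (a , b , inj₁ a<0 , inj₁ b<0 , q≤a+b)              = a , b , inj₁ a<0 , inj₁ b<0 , q≤a+b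
  to-sum (a , b , inj₂ (inj₁ x , a<1) , inj₁ b<0 , q≤a+b)   = a , b , inj₂ (x , a<1) , inj₁ b<0 , q≤a+b
  to-sum (a , b , inj₂ (inj₂ y , a<1) , inj₁ b<0 , q≤a+b)   =
    b , a , inj₁ b<0 , inj₂ (y , a<1) , ℚ.≤-trans q≤a+b (ℚ.≤-reflexive (ℚ.+-comm a b))

  from-sum : Below ([ A ] +∞ [ B ]) q → Below ([ A ⊎ B ] +∞ [ A × B ]) q
  from-sum (a , b , inj₁ a<0 , inj₁ b<0 , q≤a+b) = a , b , inj₁ a<0 , inj₁ b<0 , q≤a+b
  from-sum (a , b , inj₁ a<0 , inj₂ (y , b<1) , q≤a+b) =
    b , a , inj₂ (inj₂ y , b<1) , inj₁ a<0 , ℚ.≤-trans q≤a+b (ℚ.≤-reflexive (ℚ.+-comm a b))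
  from-sum (a , b , inj₂ (x , a<1) , inj₁ b<0 , q≤a+b) = a , b , inj₂ (inj₁ x , a<1) , inj₁ b<0 , q≤a+b
  from-sum (a , b , inj₂ (x , a<1) , inj₂ (y , b<1) , q≤a+b) =
    a , b , inj₂ (inj₁ x , a<1) , inj₂ ((x , y) , b<1) , q≤a+b

infixl 6 _+ᵛ_
infixl 7 _·ᵛ_

-- Opaque for the same reason as the module R.
opaque
  0ᵛ : Valuation X
  0ᵛ = record { measure = const-𝐑 0∞ ; strict = R.≈-refl ; modular = λ U V → R.≈-refl }

  _+ᵛ_ : Valuation X → Valuation X → Valuation X
  μ +ᵛ ν = record
    { measure = Valuation.measure μ +⇒ Valuation.measure ν
    ; strict  = R.trans (R.+-cong (Valuation.strict μ) (Valuation.strict ν)) (R.+-identityˡ 0∞)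
    ; modular = λ U V →
        R.trans (R.interchange (μ ⟪ U ∪ V ⟫) (ν ⟪ U ∪ V ⟫) (μ ⟪ U ∩ V ⟫) (ν ⟪ U ∩ V ⟫))
        (R.trans (R.+-cong (Valuation.modular μ U V) (Valuation.modular ν U V))
          (R.interchange (μ ⟪ U ⟫) (μ ⟪ V ⟫) (ν ⟪ U ⟫) (ν ⟪ V ⟫)))
    }

  _·ᵛ_ : {X : DCPO ℓ} → [0,∞] ℓ → Valuation X → Valuation X
  r ·ᵛ μ = record
    { measure = r ·⇒ Valuation.measure μ
    ; strict  = R.trans (R.·-congˡ r (Valuation.strict μ)) (R.zeroʳ r)
    ; modular = λ U V →
        R.trans (R.sym (R.distribˡ r (μ ⟪ U ∪ V ⟫) (μ ⟪ U ∩ V ⟫)))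
        (R.trans (R.·-congˡ r (Valuation.modular μ U V)) (R.distribˡ r (μ ⟪ U ⟫) (μ ⟪ V ⟫)))
    }

  δᵛ : DCPO.Carrier X → Valuation X
  δᵛ x = record
    { measure = into-𝐑 (δ x) (λ U⊆V → []-mono (⊆-elim U⊆V)) λ
        { d dir (inj₁ q<0)             → Directed.inhabitant dir , inj₁ q<0
        ; d dir (inj₂ ((i , m) , q<1)) → i , inj₂ (m , q<1) }
    ; strict  = R.≈-refl
    ; modular = λ U V → []-modular (x ∈ U) (x ∈ V)
    }

  0ᵛ-value : (U : Open X) → 0ᵛ ⟪ U ⟫ R.≈ 0∞
  0ᵛ-value U = R.≈-refl

  +ᵛ-value : (μ ν : Valuation X) (U : Open X) → (μ +ᵛ ν) ⟪ U ⟫ R.≈ μ ⟪ U ⟫ +∞ ν ⟪ U ⟫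
  +ᵛ-value μ ν U = R.≈-refl

  ·ᵛ-value : {X : DCPO ℓ} (r : [0,∞] ℓ) (μ : Valuation X) (U : Open X) → (r ·ᵛ μ) ⟪ U ⟫ R.≈ r ·∞ μ ⟪ U ⟫
  ·ᵛ-value r μ U = R.≈-refl

  δᵛ-value : (x : DCPO.Carrier X) (U : Open X) → δᵛ x ⟪ U ⟫ R.≈ δ x U
  δᵛ-value x U = R.≈-refl

-- Closure properties of minimal valuations and induction over them

Finite-1 : Finite (1∞ {ℓ})
Finite-1 = 1ℚ , λ
  { (inj₁ 1<0)       → ℚ.<-irrefl refl (ℚ.<-trans (ℚ.positive⁻¹ 1ℚ) 1<0)
  ; (inj₂ (_ , 1<1)) → ℚ.<-irrefl refl 1<1 }

Finite-· : {r s : [0,∞] ℓ} → Finite r → Finite s → Finite (r ·∞ s)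
Finite-· {r = r} {s} (p , p∉r) (q , q∉s) = p * q , λ
  { (inj₁ pq<0) → ℚ.<-irrefl refl (ℚ.≤-<-trans (0≤* (0≤ r p∉r) (0≤ s q∉s)) pq<0)
  ; (inj₂ (a , b , 0≤a , 0≤b , ra , sb , pq<ab)) → ℚ.<-irrefl refl
      (ℚ.<-≤-trans pq<ab (ℚ.≤-trans (*-mono-≤ʳ 0≤b (≤p r ra p∉r)) (*-mono-≤ˡ (0≤ r p∉r) (≤p s sb q∉s)))) }
  where
  0≤ : ∀ (r : [0,∞] ℓ) {p} → ¬ Below r p → 0ℚ ≤ p
  0≤ r p∉r = ℚ.≮⇒≥ λ p<0 → p∉r ([0,∞].negative r p<0)
  ≤p : ∀ (r : [0,∞] ℓ) {a p} → Below r a → ¬ Below r p → a ≤ p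
  ≤p r ra p∉r = ℚ.≮⇒≥ λ p<a → p∉r ([0,∞].downward r p<a ra)

-- A valuation equal to `μ` is a least upper bound of the constant family at `μ`, indexed by a
-- one-point type.
minimal-resp-≈ : {X : DCPO ℓ} (μ ν : Valuation X) → IsMinimal μ → (∀ U → μ ⟪ U ⟫ R.≈ ν ⟪ U ⟫) → IsMinimal ν
minimal-resp-≈ μ ν min μ≈ν = lub {I = Unit.⊤} (λ _ → μ)
  record { inhabitant = _ ; bounded = λ _ _ → _ , DCPO.⊑-refl (𝐕 _) , DCPO.⊑-refl (𝐕 _) }
  (λ _ → min)
  record { upper = λ _ → ≤ᵛ-intro λ U → lhs≤rhs (μ≈ν U)
         ; least = λ u ub → ≤ᵛ-intro λ U → R.≤-trans (rhs≤lhs (μ≈ν U)) (≤ᵛ-elim (ub _) U) }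

-- A least upper bound in `𝐕 X` of minimal valuations, being minimal, is also one in `𝐕ₘ X`. The
-- case of suprema is therefore stated inside `𝐕ₘ X`, where morphisms out of `𝐕ₘ X` preserve it.
minimal-rec : ∀ {p} {X : DCPO ℓ} (P : MinimalValuation X → Set p) →
  (∀ μ → IsSimple (valuation μ) → P μ) →
  (∀ {I : Set ℓ} (d : I → MinimalValuation X) → Directed (minimalValuations X) d →
     ∀ μ → IsLub (minimalValuations X) d μ → (∀ i → P (d i)) → P μ) →
  ∀ μ → P μ
minimal-rec {X = X} P P-simple P-lub μ = go (isMinimal μ)
  where
  go : ∀ {ν} (min : IsMinimal ν) → P (record { valuation = ν ; isMinimal = min })
  go (simple s)            = P-simple _ s
  go (lub d dir min isLub) = P-lub
    (λ i → record { valuation = d i ; isMinimal = min i })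
    record { inhabitant = Directed.inhabitant dir
           ; bounded    = λ i j → let k , p , q = Directed.bounded dir i j in k , ≤ᵐ-intro p , ≤ᵐ-intro q }
    _
    record { upper = λ i → ≤ᵐ-intro (IsLub.upper isLub i)
           ; least = λ u ub → ≤ᵐ-intro (IsLub.least isLub (valuation u) (λ i → ≤ᵐ-elim (ub i))) }
    (λ i → go (min i))

minimal-map : {X Y : DCPO ℓ} (Φ : 𝐕ₘ X ⇒ 𝐕 Y) → (∀ μ → IsSimple (valuation μ) → IsMinimal (to Φ μ)) →
              ∀ μ → IsMinimal (to Φ μ)
minimal-map Φ Φ-simple = minimal-rec (λ μ → IsMinimal (to Φ μ)) Φ-simple
  λ d dir μ isLub min → lub (λ i → to Φ (d i)) (map-directed Φ dir) min (preserves-lub Φ dir isLub)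

0ᵐ : MinimalValuation X
0ᵐ = record { valuation = 0ᵛ ; isMinimal = simple (0 , (λ ()) , (λ ()) , (λ ()) , 0ᵛ-value) }

δᵐ : DCPO.Carrier X → MinimalValuation X
δᵐ x = record
  { valuation = δᵛ x
  ; isMinimal = simple (1 , (λ _ → 1∞) , (λ _ → x) , (λ _ → Finite-1) ,
      λ U → R.trans (δᵛ-value x U)
        (R.sym (R.trans (R.+-identityʳ (1∞ ·∞ δ x U)) (R.*-identityˡ (δ x U))))) }

cons-value : {X : DCPO ℓ} (r : [0,∞] ℓ) (x : DCPO.Carrier X) (ν : Valuation X) (U : Open X) →
             (r ·ᵛ δᵛ x +ᵛ ν) ⟪ U ⟫ R.≈ r ·∞ δ x U +∞ ν ⟪ U ⟫
cons-value r x ν U = R.trans (+ᵛ-value (r ·ᵛ δᵛ x) ν U)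
  (R.+-congʳ (ν ⟪ U ⟫) (R.trans (·ᵛ-value r (δᵛ x) U) (R.·-congˡ r (δᵛ-value x U))))

combination : {X : DCPO ℓ} (n : ℕ) → (Fin n → [0,∞] ℓ) → (Fin n → DCPO.Carrier X) → Valuation X
combination zero    r x = 0ᵛ
combination (suc n) r x = r zero ·ᵛ δᵛ (x zero) +ᵛ combination n (λ i → r (suc i)) (λ i → x (suc i))

combination-∑ : {X : DCPO ℓ} (n : ℕ) (r : Fin n → [0,∞] ℓ) (x : Fin n → DCPO.Carrier X) (U : Open X) →
                combination n r x ⟪ U ⟫ R.≈ ∑ n (λ i → r i ·∞ δ (x i) U)
combination-∑ zero    r x U = 0ᵛ-value U
combination-∑ (suc n) r x U = R.trans
  (cons-value (r zero) (x zero) (combination n (λ i → r (suc i)) (λ i → x (suc i))) U)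
  (R.+-congˡ (r zero ·∞ δ (x zero) U) (combination-∑ n (λ i → r (suc i)) (λ i → x (suc i)) U))

·-∑ : (s : [0,∞] ℓ) (n : ℕ) (r d : Fin n → [0,∞] ℓ) →
      s ·∞ ∑ n (λ i → r i ·∞ d i) R.≈ ∑ n (λ i → s ·∞ r i ·∞ d i)
·-∑ s zero    r d = R.zeroʳ s
·-∑ s (suc n) r d = R.trans
  (R.distribˡ s (r zero ·∞ d zero) (∑ n (λ i → r (suc i) ·∞ d (suc i))))
  (R.+-cong (R.sym (R.*-assoc s (r zero) (d zero))) (·-∑ s n (λ i → r (suc i)) (λ i → d (suc i))))

module _ {ℓ : Level} {X : DCPO ℓ} where
  +ᵛ-identityˡ : (ν : Valuation X) (U : Open X) → (0ᵛ +ᵛ ν) ⟪ U ⟫ R.≈ ν ⟪ U ⟫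
  +ᵛ-identityˡ ν U = R.trans (+ᵛ-value 0ᵛ ν U)
    (R.trans (R.+-congʳ (ν ⟪ U ⟫) (0ᵛ-value U)) (R.+-identityˡ (ν ⟪ U ⟫)))

  +ᵛ-assoc : (μ ν κ : Valuation X) (U : Open X) → (μ +ᵛ ν +ᵛ κ) ⟪ U ⟫ R.≈ (μ +ᵛ (ν +ᵛ κ)) ⟪ U ⟫
  +ᵛ-assoc μ ν κ U = R.trans (+ᵛ-value (μ +ᵛ ν) κ U)
    (R.trans (R.+-congʳ (κ ⟪ U ⟫) (+ᵛ-value μ ν U))
    (R.trans (R.+-assoc (μ ⟪ U ⟫) (ν ⟪ U ⟫) (κ ⟪ U ⟫))
    (R.sym (R.trans (+ᵛ-value μ (ν +ᵛ κ) U) (R.+-congˡ (μ ⟪ U ⟫) (+ᵛ-value ν κ U))))))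

  +ᵛ-congʳ : (ν : Valuation X) {μ μ′ : Valuation X} (U : Open X) → μ ⟪ U ⟫ R.≈ μ′ ⟪ U ⟫ →
             (μ +ᵛ ν) ⟪ U ⟫ R.≈ (μ′ +ᵛ ν) ⟪ U ⟫
  +ᵛ-congʳ ν {μ} {μ′} U p = R.trans (+ᵛ-value μ ν U)
    (R.trans (R.+-congʳ (ν ⟪ U ⟫) p) (R.sym (+ᵛ-value μ′ ν U)))

  private
    add : Valuation X → 𝐕ₘ X ⇒ 𝐕 X
    add μ = into-𝐕 (λ ν → μ +ᵛ valuation ν) (λ U → const-𝐑 (μ ⟪ U ⟫) +⇒ evaluateAt U)
      (λ U ν → +ᵛ-value μ (valuation ν) U)

    addʳ : Valuation X → 𝐕ₘ X ⇒ 𝐕 X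
    addʳ ν = into-𝐕 (λ μ → valuation μ +ᵛ ν) (λ U → evaluateAt U +⇒ const-𝐑 (ν ⟪ U ⟫))
      (λ U μ → +ᵛ-value (valuation μ) ν U)

    scale : [0,∞] ℓ → 𝐕ₘ X ⇒ 𝐕 X
    scale r = into-𝐕 (λ μ → r ·ᵛ valuation μ) (λ U → r ·⇒ evaluateAt U)
      (λ U μ → ·ᵛ-value r (valuation μ) U)

    -- One more term keeps a simple valuation simple, and continuity of `add` carries this to all
    -- minimal `ν`. Iterating it adds a whole combination to an arbitrary minimal valuation.
    cons-minimal : ∀ r → Finite r → ∀ x (ν : MinimalValuation X) → IsMinimal (r ·ᵛ δᵛ x +ᵛ valuation ν)
    cons-minimal r r-fin x = minimal-map (add (r ·ᵛ δᵛ x)) λ ν (n , s , y , s-fin , ν≈) →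
      simple (suc n , (λ { zero → r ; (suc i) → s i }) , (λ { zero → x ; (suc i) → y i }) ,
        (λ { zero → r-fin ; (suc i) → s-fin i }) ,
        λ U → R.trans (cons-value r x (valuation ν) U) (R.+-congˡ (r ·∞ δ x U) (ν≈ U)))

    combination-minimal : ∀ n r (x : Fin n → DCPO.Carrier X) → (∀ i → Finite (r i)) →
                          (ν : MinimalValuation X) → IsMinimal (combination n r x +ᵛ valuation ν)
    combination-minimal zero    r x r-fin ν = minimal-resp-≈ (valuation ν) (0ᵛ +ᵛ valuation ν) (isMinimal ν)
      λ U → R.sym (+ᵛ-identityˡ (valuation ν) U)
    combination-minimal (suc n) r x r-fin ν = minimal-resp-≈
      (r zero ·ᵛ δᵛ (x zero) +ᵛ (combination n (λ i → r (suc i)) (λ i → x (suc i)) +ᵛ valuation ν))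
      (combination (suc n) r x +ᵛ valuation ν)
      (cons-minimal (r zero) (r-fin zero) (x zero) (record
        { valuation = combination n (λ i → r (suc i)) (λ i → x (suc i)) +ᵛ valuation ν
        ; isMinimal = combination-minimal n (λ i → r (suc i)) (λ i → x (suc i)) (λ i → r-fin (suc i)) ν }))
      λ U → R.sym (+ᵛ-assoc (r zero ·ᵛ δᵛ (x zero)) (combination n (λ i → r (suc i)) (λ i → x (suc i)))
            (valuation ν) U)

  infixl 6 _+ᵐ_
  -- Both summands may be suprema, so continuity is used in one argument at a time:
  -- `combination-minimal` allows any minimal right summand next to a simple left one, and `addʳ`
  -- then extends the left one.
  _+ᵐ_ : MinimalValuation X → MinimalValuation X → MinimalValuation X
  μ +ᵐ ν = record
    { valuation = valuation μ +ᵛ valuation ν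
    ; isMinimal = minimal-map (addʳ (valuation ν)) (λ μ (n , r , x , r-fin , μ≈) →
        minimal-resp-≈ (combination n r x +ᵛ valuation ν) (valuation μ +ᵛ valuation ν)
          (combination-minimal n r x r-fin ν) λ U →
          +ᵛ-congʳ (valuation ν) U (R.trans (combination-∑ n r x U) (R.sym (μ≈ U)))) μ
    }

  scaleᵐ : (r : [0,∞] ℓ) → Finite r → MinimalValuation X → MinimalValuation X
  scaleᵐ r r-fin μ = record
    { valuation = r ·ᵛ valuation μ
    ; isMinimal = minimal-map (scale r) (λ μ (n , s , x , s-fin , μ≈) →
        simple (n , (λ i → r ·∞ s i) , x , (λ i → Finite-· {r = r} {s i} r-fin (s-fin i)) ,
          λ U → R.trans (·ᵛ-value r (valuation μ) U)
            (R.trans (R.·-congˡ r (μ≈ U)) (·-∑ r n s (λ i → δ (x i) U))))) μ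
    }

  -- A sum over `Fin n` is rebuilt from `0ᵐ` one term at a time, which is the form in which
  -- linearity can be applied.
  minimal-induction : ∀ {p} (P : MinimalValuation X → Set p) →
    P 0ᵐ →
    (∀ r r-fin x μ → P μ → P (scaleᵐ r r-fin (δᵐ x) +ᵐ μ)) →
    (∀ {I : Set ℓ} (d : I → MinimalValuation X) → Directed (minimalValuations X) d →
       ∀ μ → IsLub (minimalValuations X) d μ → (∀ i → P (d i)) → P μ) →
    ∀ μ → P μ
  minimal-induction P P-0 P-cons P-lub = minimal-rec P
    (λ μ (n , r , x , r-fin , μ≈) → resp (combinationᵐ n r x r-fin) μ (P-combination n r x r-fin) λ U →
      R.trans (combination-∑ n r x U) (R.sym (μ≈ U)))
    P-lub
    where
    -- Invariance of `P` under equality is the case of suprema for a constant family.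
    resp : ∀ μ ν → P μ → (∀ U → μ ⟦ U ⟧ R.≈ ν ⟦ U ⟧) → P ν
    resp μ ν Pμ μ≈ν = P-lub {I = Unit.⊤} (λ _ → μ)
      record { inhabitant = _ ; bounded = λ _ _ → _ , DCPO.⊑-refl (𝐕ₘ X) , DCPO.⊑-refl (𝐕ₘ X) }
      ν
      record { upper = λ _ → lhs≤rhs (≈ᵐ-intro {μ = μ} {ν} μ≈ν)
             ; least = λ u ub → DCPO.⊑-trans (𝐕ₘ X) (rhs≤lhs (≈ᵐ-intro {μ = μ} {ν} μ≈ν)) (ub _) }
      (λ _ → Pμ)

    combinationᵐ : ∀ n r (x : Fin n → DCPO.Carrier X) → (∀ i → Finite (r i)) → MinimalValuation X
    combinationᵐ n r x r-fin = record
      { valuation = combination n r x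
      ; isMinimal = simple (n , r , x , r-fin , combination-∑ n r x) }

    P-combination : ∀ n r x (r-fin : ∀ i → Finite (r i)) → P (combinationᵐ n r x r-fin)
    P-combination zero    r x r-fin = resp 0ᵐ (combinationᵐ zero r x r-fin) P-0 λ U → R.≈-refl
    P-combination (suc n) r x r-fin = resp
      (scaleᵐ (r zero) (r-fin zero) (δᵐ (x zero)) +ᵐ
        combinationᵐ n (λ i → r (suc i)) (λ i → x (suc i)) (λ i → r-fin (suc i)))
      (combinationᵐ (suc n) r x r-fin)
      (P-cons (r zero) (r-fin zero) (x zero)
        (combinationᵐ n (λ i → r (suc i)) (λ i → x (suc i)) (λ i → r-fin (suc i)))
        (P-combination n (λ i → r (suc i)) (λ i → x (suc i)) (λ i → r-fin (suc i))))
      λ U → R.≈-refl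

-- Linear functionals and the monad

-- The scalars are finite because they stand for the coefficients of simple valuations.
record Linear {X : DCPO ℓ} (F : MinimalValuation X → [0,∞] ℓ) : Set (lsuc ℓ) where
  field
    F-0 : F 0ᵐ R.≈ 0∞
    F-+ : ∀ μ ν → F (μ +ᵐ ν) R.≈ F μ +∞ F ν
    F-· : ∀ r r-fin μ → F (scaleᵐ r r-fin μ) R.≈ r ·∞ F μ

open Linear

0-linear : {X : DCPO ℓ} → Linear {X = X} (λ _ → 0∞)
0-linear = record
  { F-0 = R.≈-refl
  ; F-+ = λ μ ν → R.sym (R.+-identityˡ 0∞)
  ; F-· = λ r r-fin μ → R.sym (R.zeroʳ r)
  }

+-linear : {X : DCPO ℓ} (F G : MinimalValuation X → [0,∞] ℓ) → Linear F → Linear G → Linear (λ μ → F μ +∞ G μ)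
+-linear F G F-lin G-lin = record
  { F-0 = R.trans (R.+-cong (F-0 F-lin) (F-0 G-lin)) (R.+-identityˡ 0∞)
  ; F-+ = λ μ ν → R.trans (R.+-cong (F-+ F-lin μ ν) (F-+ G-lin μ ν)) (R.interchange (F μ) (F ν) (G μ) (G ν))
  ; F-· = λ r r-fin μ → R.trans (R.+-cong (F-· F-lin r r-fin μ) (F-· G-lin r r-fin μ))
      (R.sym (R.distribˡ r (F μ) (G μ)))
  }

·-linear : {X : DCPO ℓ} (s : [0,∞] ℓ) (F : MinimalValuation X → [0,∞] ℓ) → Linear F → Linear (λ μ → s ·∞ F μ)
·-linear s F F-lin = record
  { F-0 = R.trans (R.·-congˡ s (F-0 F-lin)) (R.zeroʳ s)
  ; F-+ = λ μ ν → R.trans (R.·-congˡ s (F-+ F-lin μ ν)) (R.distribˡ s (F μ) (F ν))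
  ; F-· = λ r r-fin μ → R.trans (R.·-congˡ s (F-· F-lin r r-fin μ)) (R.x∙yz≈y∙xz s r (F μ))
  }

evaluateAt-linear : (U : Open X) → Linear (to (evaluateAt U))
evaluateAt-linear U = record
  { F-0 = 0ᵛ-value U
  ; F-+ = λ μ ν → +ᵛ-value (valuation μ) (valuation ν) U
  ; F-· = λ r r-fin μ → ·ᵛ-value r (valuation μ) U
  }

integral : (X ⇒ 𝐑) → 𝐕ₘ X ⇒ 𝐑
integral h = riemannIntegral⇒ (λ t → evaluateAt (h ⁻¹] t ,∞]))

integral-antitone : {X : DCPO ℓ} (h : X ⇒ 𝐑) (μ : MinimalValuation X) → Antitone (λ t → μ ⟦ h ⁻¹] t ,∞] ⟧)
integral-antitone h μ s≤t = _⇒_.monotone (Valuation.measure (valuation μ))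
  (⊆-intro λ {x} → below-≤ (to h x) s≤t)

integral-linear : {X : DCPO ℓ} (h : X ⇒ 𝐑) → Linear (to (integral h))
integral-linear h = record
  { F-0 = R.trans (riemannIntegral-cong λ t → 0ᵛ-value (h ⁻¹] t ,∞])) riemannIntegral-0
  ; F-+ = λ μ ν → R.trans
      (riemannIntegral-cong λ t → +ᵛ-value (valuation μ) (valuation ν) (h ⁻¹] t ,∞]))
      (riemannIntegral-+ {f = λ t → μ ⟦ h ⁻¹] t ,∞] ⟧} {λ t → ν ⟦ h ⁻¹] t ,∞] ⟧}
        (integral-antitone h μ) (integral-antitone h ν))
  ; F-· = λ r r-fin μ → R.trans
      (riemannIntegral-cong λ t → ·ᵛ-value r (valuation μ) (h ⁻¹] t ,∞]))
      (riemannIntegral-· r (λ t → μ ⟦ h ⁻¹] t ,∞] ⟧))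
  }

-- At level `t` the Dirac valuation measures the superlevel set by `[ Below (to h x) t ]`, so the
-- integral is the length of the set of levels below `to h x`.
integral-δ : {X : DCPO ℓ} (h : X ⇒ 𝐑) (x : DCPO.Carrier X) → to (integral h) (δᵐ x) R.≈ to h x
integral-δ h x = R.trans (riemannIntegral-cong λ t → δᵛ-value x (h ⁻¹] t ,∞])) (riemannIntegral-levels (to h x))

linear-cons : {X : DCPO ℓ} (F : MinimalValuation X → [0,∞] ℓ) → Linear F → ∀ r r-fin x μ →
              F (scaleᵐ r r-fin (δᵐ x) +ᵐ μ) R.≈ r ·∞ F (δᵐ x) +∞ F μ
linear-cons F F-lin r r-fin x μ = R.trans (F-+ F-lin (scaleᵐ r r-fin (δᵐ x)) μ)
  (R.+-congʳ (F μ) (F-· F-lin r r-fin (δᵐ x)))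

linear-unique : {X : DCPO ℓ} (F G : 𝐕ₘ X ⇒ 𝐑) → Linear (to F) → Linear (to G) →
                (∀ x → to F (δᵐ x) R.≈ to G (δᵐ x)) → F ≐ G
linear-unique {X = X} F G F-lin G-lin F≈G = minimal-induction (λ μ → to F μ R.≈ to G μ)
  (R.trans (F-0 F-lin) (R.sym (F-0 G-lin)))
  (λ r r-fin x μ Fμ≈Gμ → R.trans (linear-cons (to F) F-lin r r-fin x μ)
    (R.trans (R.+-cong (R.·-congˡ r (F≈G x)) Fμ≈Gμ)
      (R.sym (linear-cons (to G) G-lin r r-fin x μ))))
  (λ d dir μ isLub Fd≈Gd →
    IsLub.least (preserves-lub F dir isLub) (to G μ)
      (λ i → R.≤-trans (lhs≤rhs (Fd≈Gd i)) (IsLub.upper (preserves-lub G dir isLub) i)) ⇌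
    IsLub.least (preserves-lub G dir isLub) (to F μ)
      (λ i → R.≤-trans (rhs≤lhs (Fd≈Gd i)) (IsLub.upper (preserves-lub F dir isLub) i)))

-- Each `f x` is continuous in the open set `V`, hence so are the superlevel sets of the integrand.
-- This yields the continuity of `bindᵛ f μ` as a map on open sets.
superlevel : {X Y : DCPO ℓ} → X ⇒ 𝐕ₘ Y → ℚ → 𝒪 Y ⇒ 𝒪 X
superlevel {X = X} {Y} f t = record
  { to         = λ V → (evaluateAt V ∘ f) ⁻¹] t ,∞]
  ; monotone   = mono
  ; continuous = λ d dir → record
      { upper = λ i → mono (IsLub.upper (DCPO.⋁-isLub (𝒪 Y) d dir) i)
      ; least = λ U ub → ⊆-intro λ {x} b →
          let i , b′ = below-⋁ (Valuation.measure (valuation (to f x))) d dir b in ⊆-elim (ub i) b′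
      }
  }
  where
  mono : ∀ {U V : Open Y} → U ⊆ V → (evaluateAt U ∘ f) ⁻¹] t ,∞] ⊆ (evaluateAt V ∘ f) ⁻¹] t ,∞]
  mono U⊆V = ⊆-intro λ {x} → ≤∞-elim (_⇒_.monotone (Valuation.measure (valuation (to f x))) U⊆V)

LinearMap : {X Y : DCPO ℓ} → 𝐕ₘ X ⇒ 𝐕ₘ Y → Set (lsuc ℓ)
LinearMap F = ∀ V → Linear (λ μ → to F μ ⟦ V ⟧)

module _ {ℓ : Level} {X Y : DCPO ℓ} (f : X ⇒ 𝐕ₘ Y) where
  private
    I : Open Y → 𝐕ₘ X ⇒ 𝐑
    I V = integral (evaluateAt V ∘ f)

  bindᵛ : MinimalValuation X → Valuation Y
  bindᵛ μ = record
    -- The same expression is a morphism in the open set here and a morphism in the valuation in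
    -- `I`, so facts about `I V` apply to this measure as they stand.
    { measure = riemannIntegral⇒ (λ t → Valuation.measure (valuation μ) ∘ superlevel f t)
    ; strict  = linear-unique (I ∅) (const-𝐑 0∞) (integral-linear (evaluateAt ∅ ∘ f)) 0-linear
        (λ x → R.trans (integral-δ (evaluateAt ∅ ∘ f) x) (Valuation.strict (valuation (to f x)))) μ
    ; modular = λ U V → linear-unique (I (U ∪ V) +⇒ I (U ∩ V)) (I U +⇒ I V)
        (+-linear (to (I (U ∪ V))) (to (I (U ∩ V)))
          (integral-linear (evaluateAt (U ∪ V) ∘ f)) (integral-linear (evaluateAt (U ∩ V) ∘ f)))
        (+-linear (to (I U)) (to (I V)) (integral-linear (evaluateAt U ∘ f)) (integral-linear (evaluateAt V ∘ f)))
        (λ x → R.trans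
          (R.+-cong (integral-δ (evaluateAt (U ∪ V) ∘ f) x) (integral-δ (evaluateAt (U ∩ V) ∘ f) x))
          (R.trans (Valuation.modular (valuation (to f x)) U V)
            (R.sym (R.+-cong (integral-δ (evaluateAt U ∘ f) x) (integral-δ (evaluateAt V ∘ f) x)))))
        μ
    }

  bind⇒ : 𝐕ₘ X ⇒ 𝐕 Y
  bind⇒ = into-𝐕 bindᵛ I (λ V μ → R.≈-refl)

  -- On a simple valuation the result is a finite combination of the valuations `to f x`, which are
  -- minimal but in general not simple. This is where the closure under `+ᵐ` and `scaleᵐ` enters.
  bind-minimal : ∀ μ → IsMinimal (bindᵛ μ)
  bind-minimal = minimal-induction (λ μ → IsMinimal (bindᵛ μ))
    (minimal-resp-≈ 0ᵛ (bindᵛ 0ᵐ) (isMinimal 0ᵐ) λ V →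
      R.trans (0ᵛ-value V) (R.sym (F-0 (integral-linear (evaluateAt V ∘ f)))))
    (λ r r-fin x μ min →
      let ν = record { valuation = bindᵛ μ ; isMinimal = min }
          κ = scaleᵐ r r-fin (to f x) +ᵐ ν
      in minimal-resp-≈ (valuation κ) (bindᵛ (scaleᵐ r r-fin (δᵐ x) +ᵐ μ)) (isMinimal κ) λ V →
        R.trans (+ᵛ-value (valuation (scaleᵐ r r-fin (to f x))) (bindᵛ μ) V)
        (R.trans (R.+-congʳ (bindᵛ μ ⟪ V ⟫) (R.trans (·ᵛ-value r (valuation (to f x)) V)
            (R.·-congˡ r (R.sym (integral-δ (evaluateAt V ∘ f) x)))))
          (R.sym (linear-cons (to (I V)) (integral-linear (evaluateAt V ∘ f)) r r-fin x μ))))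
    λ d dir μ isLub min → lub (λ i → bindᵛ (d i)) (map-directed bind⇒ dir) min (preserves-lub bind⇒ dir isLub)

opaque
  bind : {X Y : DCPO ℓ} → X ⇒ 𝐕ₘ Y → 𝐕ₘ X ⇒ 𝐕ₘ Y
  bind f = into-𝐕ₘ (λ μ → record { valuation = bindᵛ f μ ; isMinimal = bind-minimal f μ })
    (λ V → integral (evaluateAt V ∘ f)) (λ V μ → R.≈-refl)

  bind-value : {X Y : DCPO ℓ} (f : X ⇒ 𝐕ₘ Y) (μ : MinimalValuation X) (V : Open Y) →
               to (bind f) μ ⟦ V ⟧ R.≈ ∫ (evaluateAt V ∘ f) (valuation μ)
  bind-value f μ V = R.≈-refl

  bind-linear : {X Y : DCPO ℓ} (f : X ⇒ 𝐕ₘ Y) → LinearMap (bind f)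
  bind-linear f V = integral-linear (evaluateAt V ∘ f)

  dirac : (X : DCPO ℓ) → X ⇒ 𝐕ₘ X
  dirac X = into-𝐕ₘ δᵐ
    (λ U → into-𝐑 (λ x → δ x U) (λ x⊑y → []-mono (Open.upward U x⊑y)) λ
      { d dir (inj₁ q<0)       → Directed.inhabitant dir , inj₁ q<0
      ; d dir (inj₂ (m , q<1)) → let i , m′ = Open.inaccessible U d dir m in i , inj₂ (m′ , q<1) })
    (λ U x → δᵛ-value x U)

  dirac-value : (X : DCPO ℓ) (x : DCPO.Carrier X) (U : Open X) → to (dirac X) x ⟦ U ⟧ R.≈ δ x U
  dirac-value X x U = δᵛ-value x U

  bind-δ : {X Y : DCPO ℓ} (f : X ⇒ 𝐕ₘ Y) (x : DCPO.Carrier X) → to (bind f) (to (dirac X) x) ≈ᵐ to f x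
  bind-δ {X = X} f x = ≈ᵐ-intro {μ = to (bind f) (to (dirac X) x)} {to f x} λ V → integral-δ (evaluateAt V ∘ f) x

  -- Outside this block `dirac` does not unfold to `δᵐ`, so the uniqueness principle is restated in
  -- terms of `dirac`.
  linear-ext : {X : DCPO ℓ} (F G : 𝐕ₘ X ⇒ 𝐑) → Linear (to F) → Linear (to G) →
               (∀ x → to F (to (dirac X) x) R.≈ to G (to (dirac X) x)) → F ≐ G
  linear-ext = linear-unique

-- Linearity of `F`, given at each open set, is assembled into equalities of minimal valuations,
-- which `G` respects.
linear-∘ : {X Y : DCPO ℓ} (F : 𝐕ₘ X ⇒ 𝐕ₘ Y) (G : 𝐕ₘ Y ⇒ 𝐑) →
           LinearMap F → Linear (to G) → Linear (λ μ → to G (to F μ))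
linear-∘ F G F-lin G-lin = record
  { F-0 = R.trans (resp-≈ G (≈ᵐ-intro {μ = to F 0ᵐ} {0ᵐ} λ V →
      R.trans (F-0 (F-lin V)) (R.sym (0ᵛ-value V)))) (F-0 G-lin)
  ; F-+ = λ μ ν → R.trans
      (resp-≈ G (≈ᵐ-intro {μ = to F (μ +ᵐ ν)} {to F μ +ᵐ to F ν} λ V →
        R.trans (F-+ (F-lin V) μ ν) (R.sym (+ᵛ-value (valuation (to F μ)) (valuation (to F ν)) V))))
      (F-+ G-lin (to F μ) (to F ν))
  ; F-· = λ r r-fin μ → R.trans
      (resp-≈ G (≈ᵐ-intro {μ = to F (scaleᵐ r r-fin μ)} {scaleᵐ r r-fin (to F μ)} λ V →
        R.trans (F-· (F-lin V) r r-fin μ) (R.sym (·ᵛ-value r (valuation (to F μ)) V))))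
      (F-· G-lin r r-fin (to F μ))
  }

linearMap-∘ : {X Y Z : DCPO ℓ} (F : 𝐕ₘ X ⇒ 𝐕ₘ Y) (G : 𝐕ₘ Y ⇒ 𝐕ₘ Z) →
              LinearMap F → LinearMap G → LinearMap (G ∘ F)
linearMap-∘ F G F-lin G-lin V = linear-∘ F (evaluateAt V ∘ G) F-lin (G-lin V)

linearMap-ext : {X Y : DCPO ℓ} (F G : 𝐕ₘ X ⇒ 𝐕ₘ Y) → LinearMap F → LinearMap G →
                (∀ x → to F (to (dirac X) x) ≈ᵐ to G (to (dirac X) x)) → F ≐ G
linearMap-ext {X = X} F G F-lin G-lin F≈G μ = ≈ᵐ-intro {μ = to F μ} {to G μ} λ V →
  linear-ext (evaluateAt V ∘ F) (evaluateAt V ∘ G) (F-lin V) (G-lin V)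
    (λ x → ≈ᵐ-elim {μ = to F (to (dirac X) x)} {to G (to (dirac X) x)} (F≈G x) V) μ

bind-cong : {X Y : DCPO ℓ} {f g : X ⇒ 𝐕ₘ Y} → f ≐ g → bind f ≐ bind g
bind-cong {Y = Y} {f = f} {g} f≐g = linearMap-ext (bind f) (bind g) (bind-linear f) (bind-linear g) λ x →
  trans (bind-δ f x) (trans (f≐g x) (sym (bind-δ g x)))
  where open DCPO.≈ (𝐕ₘ Y)

bind-dirac : (X : DCPO ℓ) → bind (dirac X) ≐ id (𝐕ₘ X)
bind-dirac X = linearMap-ext (bind (dirac X)) (id (𝐕ₘ X))
  (bind-linear (dirac X)) evaluateAt-linear (bind-δ (dirac X))

bind-∘ : {X Y Z : DCPO ℓ} (f : X ⇒ 𝐕ₘ Y) (g : Y ⇒ 𝐕ₘ Z) → bind (bind g ∘ f) ≐ bind g ∘ bind f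
bind-∘ {Z = Z} f g = linearMap-ext (bind (bind g ∘ f)) (bind g ∘ bind f)
  (bind-linear (bind g ∘ f)) (linearMap-∘ (bind f) (bind g) (bind-linear f) (bind-linear g))
  λ x → DCPO.≈.trans (𝐕ₘ Z) (bind-δ (bind g ∘ f) x) (DCPO.≈.sym (𝐕ₘ Z) (resp-≈ (bind g) (bind-δ f x)))

minimalMonad : Monad (𝐕ₘ {ℓ})
minimalMonad = record
  { η      = dirac
  ; _†     = bind
  ; †-cong = bind-cong
  ; †-η    = bind-δ
  ; η-†    = bind-dirac
  ; †-∘    = bind-∘
  }

-- The strength and commutativity

const⇒ : {X Y : DCPO ℓ} → DCPO.Carrier Y → X ⇒ Y
const⇒ {Y = Y} y = record
  { to         = λ _ → y
  ; monotone   = λ _ → DCPO.⊑-refl Y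
  ; continuous = λ d dir → record { upper = λ _ → DCPO.⊑-refl Y ; least = λ u ub → ub (Directed.inhabitant dir) }
  }

pair : (X Y : DCPO ℓ) → DCPO.Carrier X → Y ⇒ X ⊗ Y
pair X Y x = ⟨ const⇒ x , id Y ⟩

slice-monotone : {X Y : DCPO ℓ} (W : Open (X ⊗ Y)) {x x′ : DCPO.Carrier X} → DCPO._⊑_ X x x′ →
                 slice X Y W x ⊆ slice X Y W x′
slice-monotone {Y = Y} W x⊑x′ = ⊆-intro (Open.upward W (x⊑x′ , DCPO.⊑-refl Y))

-- For fixed `y` the section of `W` along `X` is a slice of the swapped open set, hence
-- inaccessible.
slice-⋁ : {X Y : DCPO ℓ} (W : Open (X ⊗ Y)) {I : Set ℓ} (d : I → DCPO.Carrier X) (dir : Directed (DCPO.poset X) d) →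
          ∀ {y} → y ∈ slice X Y W (DCPO.⋁ X d dir) → ∃[ i ] y ∈ slice X Y W (d i)
slice-⋁ {X = X} {Y} W {I} d dir {y} = Open.inaccessible (slice Y X (swap⁻¹ W) y) d dir
  where
  swap⁻¹ : Open (X ⊗ Y) → Open (Y ⊗ X)
  swap⁻¹ W = record
    { Holds        = λ (y , x) → (x , y) ∈ W
    ; upward       = λ (p , q) → Open.upward W (q , p)
    ; inaccessible = λ d dir → Open.inaccessible W (λ i → proj₂ (d i) , proj₁ (d i)) (map-directed (swap Y X) dir)
    }

-- Joint continuity follows from separate continuity: the valuation is approximated by that of `d j`
-- with the slice at the supremum kept, then the slice by that of `d i` for this valuation, and
-- directedness provides a common `k`.
sliceValue : {X Y : DCPO ℓ} (W : Open (X ⊗ Y)) → X ⊗ 𝐕ₘ Y ⇒ 𝐑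
sliceValue {X = X} {Y} W = into-𝐑 (λ (x , ν) → ν ⟦ slice X Y W x ⟧)
  (λ {(x , ν)} {(x′ , ν′)} (p , q) → R.≤-trans
    (_⇒_.monotone (Valuation.measure (valuation ν)) (slice-monotone W p))
    (_⇒_.monotone (evaluateAt (slice X Y W x′)) q))
  λ d dir b → let
    j , b₁    = below-⋁ (evaluateAt (slice X Y W (proj₁ (DCPO.⋁ (X ⊗ 𝐕ₘ Y) d dir)))) (λ i → proj₂ (d i))
                  (map-directed (π₂ X (𝐕ₘ Y)) dir) b
    dir₁      = map-directed (π₁ X (𝐕ₘ Y)) dir
    slices    = λ i → slice X Y W (proj₁ (d i))
    dir′      = record
      { inhabitant = Directed.inhabitant dir
      ; bounded    = λ i j → let k , p , q = Directed.bounded dir i j in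
                     k , slice-monotone W (proj₁ p) , slice-monotone W (proj₁ q) }
    m         = Valuation.measure (valuation (proj₂ (d j)))
    i , b₂    = below-⋁ m slices dir′
                  (≤∞-elim (_⇒_.monotone m (⊆-intro λ y∈ → slice-⋁ W (λ i → proj₁ (d i)) dir₁ y∈)) b₁)
    k , p , q = Directed.bounded dir i j
  in k , ≤∞-elim (_⇒_.monotone (evaluateAt (slices k)) (proj₂ q))
           (≤∞-elim (_⇒_.monotone m (slice-monotone W (proj₁ p))) b₂)

-- The strength is built as the Kleisli extension of `y ↦ δ (x , y)`, from which it inherits
-- minimality and linearity in `ν`; its explicit formula is recovered here.
bind-pair-value : {X Y : DCPO ℓ} (x : DCPO.Carrier X) (ν : MinimalValuation Y) (W : Open (X ⊗ Y)) →
  to (bind (dirac (X ⊗ Y) ∘ pair X Y x)) ν ⟦ W ⟧ R.≈ ν ⟦ slice X Y W x ⟧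
bind-pair-value {X = X} {Y} x ν W = linear-ext (evaluateAt W ∘ bind k) (evaluateAt (slice X Y W x))
  (bind-linear k W) (evaluateAt-linear (slice X Y W x))
  (λ y → R.trans (≈ᵐ-elim {μ = to (bind k) (to (dirac Y) y)} {to k y} (bind-δ k y) W)
    (R.trans (dirac-value (X ⊗ Y) (x , y) W) (R.sym (dirac-value Y y (slice X Y W x)))))
  ν
  where
  k : Y ⇒ 𝐕ₘ (X ⊗ Y)
  k = dirac (X ⊗ Y) ∘ pair X Y x

opaque
  strength : (X Y : DCPO ℓ) → X ⊗ 𝐕ₘ Y ⇒ 𝐕ₘ (X ⊗ Y)
  strength X Y = into-𝐕ₘ (λ (x , ν) → to (bind (dirac (X ⊗ Y) ∘ pair X Y x)) ν) sliceValue
    (λ W (x , ν) → bind-pair-value x ν W)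

  strength-value : (X Y : DCPO ℓ) (x : DCPO.Carrier X) (ν : MinimalValuation Y) (W : Open (X ⊗ Y)) →
                   to (strength X Y) (x , ν) ⟦ W ⟧ R.≈ ν ⟦ slice X Y W x ⟧
  strength-value X Y x ν W = bind-pair-value x ν W

  strength-linear : (X Y : DCPO ℓ) (x : DCPO.Carrier X) → LinearMap (strength X Y ∘ pair X (𝐕ₘ Y) x)
  strength-linear X Y x = bind-linear (dirac (X ⊗ Y) ∘ pair X Y x)

  strength-δ : (X Y : DCPO ℓ) (x : DCPO.Carrier X) (y : DCPO.Carrier Y) →
               to (strength X Y) (x , to (dirac Y) y) ≈ᵐ to (dirac (X ⊗ Y)) (x , y)
  strength-δ X Y x y = bind-δ (dirac (X ⊗ Y) ∘ pair X Y x) y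

private module 𝐕ₘ-Monad {ℓ : Level} = Monad (minimalMonad {ℓ})
open 𝐕ₘ-Monad using (fmap; join)

module _ {ℓ : Level} {X Y : DCPO ℓ} where
  fmap-linear : (f : X ⇒ Y) → LinearMap (fmap f)
  fmap-linear f = bind-linear (dirac Y ∘ f)

  fmap-δ : (f : X ⇒ Y) (x : DCPO.Carrier X) → to (fmap f) (to (dirac X) x) ≈ᵐ to (dirac Y) (to f x)
  fmap-δ f = bind-δ (dirac Y ∘ f)

-- Linearity makes sense only in the second component, so the first is frozen by `pair`; both sides
-- then become composites of linear maps. The other coherence laws are treated likewise.
strength-natural : {X X′ Y Y′ : DCPO ℓ} (f : X ⇒ X′) (g : Y ⇒ Y′) →
  fmap (f ⊗₁ g) ∘ strength X Y ≐ strength X′ Y′ ∘ (f ⊗₁ fmap g)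
strength-natural {X = X} {X′} {Y} {Y′} f g (x , ν) = linearMap-ext
  (fmap (f ⊗₁ g) ∘ (strength X Y ∘ pair X (𝐕ₘ Y) x))
  ((strength X′ Y′ ∘ pair X′ (𝐕ₘ Y′) (to f x)) ∘ fmap g)
  (linearMap-∘ (strength X Y ∘ pair X (𝐕ₘ Y) x) (fmap (f ⊗₁ g)) (strength-linear X Y x) (fmap-linear (f ⊗₁ g)))
  (linearMap-∘ (fmap g) (strength X′ Y′ ∘ pair X′ (𝐕ₘ Y′) (to f x)) (fmap-linear g) (strength-linear X′ Y′ (to f x)))
  (λ y → trans (resp-≈ (fmap (f ⊗₁ g)) (strength-δ X Y x y)) (trans (fmap-δ (f ⊗₁ g) (x , y))
    (sym (trans (resp-≈ (strength X′ Y′ ∘ pair X′ (𝐕ₘ Y′) (to f x)) (fmap-δ g y))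
      (strength-δ X′ Y′ (to f x) (to g y))))))
  ν
  where open DCPO.≈ (𝐕ₘ (X′ ⊗ Y′))

strength-unit : (X : DCPO ℓ) → fmap (π₂ 𝟏 X) ∘ strength 𝟏 X ≐ π₂ 𝟏 (𝐕ₘ X)
strength-unit X (x , ν) = linearMap-ext
  (fmap (π₂ 𝟏 X) ∘ (strength 𝟏 X ∘ pair 𝟏 (𝐕ₘ X) x)) (id (𝐕ₘ X))
  (linearMap-∘ (strength 𝟏 X ∘ pair 𝟏 (𝐕ₘ X) x) (fmap (π₂ 𝟏 X)) (strength-linear 𝟏 X x) (fmap-linear (π₂ 𝟏 X)))
  evaluateAt-linear
  (λ y → trans (resp-≈ (fmap (π₂ 𝟏 X)) (strength-δ 𝟏 X x y)) (fmap-δ (π₂ 𝟏 X) (x , y)))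
  ν
  where open DCPO.≈ (𝐕ₘ X)

strength-assoc : (X Y Z : DCPO ℓ) →
  fmap (assoc X Y Z) ∘ strength (X ⊗ Y) Z ≐ strength X (Y ⊗ Z) ∘ (id X ⊗₁ strength Y Z) ∘ assoc X Y (𝐕ₘ Z)
strength-assoc X Y Z ((x , y) , ν) = linearMap-ext
  (fmap (assoc X Y Z) ∘ s₁) (s₃ ∘ s₂)
  (linearMap-∘ s₁ (fmap (assoc X Y Z)) (strength-linear (X ⊗ Y) Z (x , y)) (fmap-linear (assoc X Y Z)))
  (linearMap-∘ s₂ s₃ (strength-linear Y Z y) (strength-linear X (Y ⊗ Z) x))
  (λ z → trans (resp-≈ (fmap (assoc X Y Z)) (strength-δ (X ⊗ Y) Z (x , y) z))
    (trans (fmap-δ (assoc X Y Z) ((x , y) , z))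
    (sym (trans (resp-≈ s₃ (strength-δ Y Z y z)) (strength-δ X (Y ⊗ Z) x (y , z))))))
  ν
  where
  open DCPO.≈ (𝐕ₘ (X ⊗ (Y ⊗ Z)))
  s₁ = strength (X ⊗ Y) Z ∘ pair (X ⊗ Y) (𝐕ₘ Z) (x , y)
  s₂ = strength Y Z ∘ pair Y (𝐕ₘ Z) y
  s₃ = strength X (Y ⊗ Z) ∘ pair X (𝐕ₘ (Y ⊗ Z)) x

strength-join : (X Y : DCPO ℓ) →
  strength X Y ∘ (id X ⊗₁ join Y) ≐ join (X ⊗ Y) ∘ fmap (strength X Y) ∘ strength X (𝐕ₘ Y)
strength-join X Y (x , κ) = linearMap-ext
  (s ∘ join Y) (join (X ⊗ Y) ∘ (fmap (strength X Y) ∘ s′))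
  (linearMap-∘ (join Y) s (bind-linear (id (𝐕ₘ Y))) (strength-linear X Y x))
  (linearMap-∘ (fmap (strength X Y) ∘ s′) (join (X ⊗ Y))
    (linearMap-∘ s′ (fmap (strength X Y)) (strength-linear X (𝐕ₘ Y) x) (fmap-linear (strength X Y)))
    (bind-linear (id (𝐕ₘ (X ⊗ Y)))))
  (λ ν → trans (resp-≈ s (bind-δ (id (𝐕ₘ Y)) ν))
    (sym (trans (resp-≈ (join (X ⊗ Y) ∘ fmap (strength X Y)) (strength-δ X (𝐕ₘ Y) x ν))
      (trans (resp-≈ (join (X ⊗ Y)) (fmap-δ (strength X Y) (x , ν)))
        (bind-δ (id (𝐕ₘ (X ⊗ Y))) (to (strength X Y) (x , ν)))))))
  κ
  where
  open DCPO.≈ (𝐕ₘ (X ⊗ Y))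
  s  = strength X Y ∘ pair X (𝐕ₘ Y) x
  s′ = strength X (𝐕ₘ Y) ∘ pair X (𝐕ₘ (𝐕ₘ Y)) x

minimalStrength : Strength (minimalMonad {ℓ})
minimalStrength = record
  { t        = strength
  ; natural  = strength-natural
  ; t-unit   = strength-unit
  ; t-assoc  = strength-assoc
  ; t-η      = λ X Y (x , y) → strength-δ X Y x y
  ; t-join   = strength-join
  }

-- Commutativity

module _ {ℓ : Level} (X Y : DCPO ℓ) where
  open Strength (minimalStrength {ℓ}) using (t′)
  open DCPO.≈ (𝐕ₘ (X ⊗ Y))

  private
    T = 𝐕ₘ {ℓ}

    lhs rhs : T X ⊗ T Y ⇒ T (X ⊗ Y)
    lhs = bind (t′ X Y) ∘ strength (T X) Y
    rhs = bind (strength X Y) ∘ t′ X (T Y)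

    t′-linear : (Z : DCPO ℓ) (z : DCPO.Carrier Z) → LinearMap (t′ X Z ∘ swap Z (T X) ∘ pair Z (T X) z)
    t′-linear Z z = linearMap-∘ (strength Z X ∘ pair Z (T X) z) (fmap (swap Z X))
      (strength-linear Z X z) (fmap-linear (swap Z X))

    t′-δ : (Z : DCPO ℓ) (x : DCPO.Carrier X) (z : DCPO.Carrier Z) →
           to (t′ X Z) (to (dirac X) x , z) ≈ᵐ to (dirac (X ⊗ Z)) (x , z)
    t′-δ Z x z = DCPO.≈.trans (T (X ⊗ Z))
      (resp-≈ (fmap (swap Z X)) (strength-δ Z X z x)) (fmap-δ (swap Z X) (z , x))

    lhs-linear₂ : (μ : MinimalValuation X) → LinearMap (lhs ∘ pair (T X) (T Y) μ)
    lhs-linear₂ μ = linearMap-∘ (strength (T X) Y ∘ pair (T X) (T Y) μ) (bind (t′ X Y))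
      (strength-linear (T X) Y μ) (bind-linear (t′ X Y))

    lhs-δ₂ : (μ : MinimalValuation X) (y : DCPO.Carrier Y) → to lhs (μ , to (dirac Y) y) ≈ᵐ to (t′ X Y) (μ , y)
    lhs-δ₂ μ y = trans (resp-≈ (bind (t′ X Y)) (strength-δ (T X) Y μ y)) (bind-δ (t′ X Y) (μ , y))

    lhs-value-δ₂ : (W : Open (X ⊗ Y)) (μ : MinimalValuation X) (y : DCPO.Carrier Y) →
                   to lhs (μ , to (dirac Y) y) ⟦ W ⟧ R.≈ to (t′ X Y) (μ , y) ⟦ W ⟧
    lhs-value-δ₂ W μ y = ≈ᵐ-elim {μ = to lhs (μ , to (dirac Y) y)} {to (t′ X Y) (μ , y)} (lhs-δ₂ μ y) W

    -- This is the exchange of the two variables. The inner strength treats `μ` as a mere point of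
    -- `T X`, so linearity in `μ` is not that of a composite. Instead each law is read, for fixed
    -- valuations on `X`, as an equation between functionals linear in `ν`; at a Dirac valuation of
    -- `y` it becomes the linearity of `t′` in its first argument.
    lhs-linear₁ : (ν : MinimalValuation Y) → LinearMap (lhs ∘ swap (T Y) (T X) ∘ pair (T Y) (T X) ν)
    lhs-linear₁ ν W = record
      { F-0 = linear-ext (L 0ᵐ) (const-𝐑 0∞) (lhs-linear₂ 0ᵐ W) 0-linear
          (λ y → R.trans (lhs-value-δ₂ W 0ᵐ y) (Linear.F-0 (t′-linear Y y W))) ν
      ; F-+ = λ μ₁ μ₂ → linear-ext (L (μ₁ +ᵐ μ₂)) (L μ₁ +⇒ L μ₂) (lhs-linear₂ (μ₁ +ᵐ μ₂) W)
          (+-linear (to (L μ₁)) (to (L μ₂)) (lhs-linear₂ μ₁ W) (lhs-linear₂ μ₂ W))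
          (λ y → R.trans (lhs-value-δ₂ W (μ₁ +ᵐ μ₂) y) (R.trans (Linear.F-+ (t′-linear Y y W) μ₁ μ₂)
            (R.sym (R.+-cong (lhs-value-δ₂ W μ₁ y) (lhs-value-δ₂ W μ₂ y))))) ν
      ; F-· = λ r r-fin μ → linear-ext (L (scaleᵐ r r-fin μ)) (r ·⇒ L μ) (lhs-linear₂ (scaleᵐ r r-fin μ) W)
          (·-linear r (to (L μ)) (lhs-linear₂ μ W))
          (λ y → R.trans (lhs-value-δ₂ W (scaleᵐ r r-fin μ) y) (R.trans (Linear.F-· (t′-linear Y y W) r r-fin μ)
            (R.sym (R.·-congˡ r (lhs-value-δ₂ W μ y))))) ν
      }
      where
      L : MinimalValuation X → T Y ⇒ 𝐑
      L μ = evaluateAt W ∘ lhs ∘ pair (T X) (T Y) μ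

    lhs-δ₁ : (x : DCPO.Carrier X) (ν : MinimalValuation Y) → to lhs (to (dirac X) x , ν) ≈ᵐ to (strength X Y) (x , ν)
    lhs-δ₁ x = linearMap-ext (lhs ∘ pair (T X) (T Y) (to (dirac X) x)) (strength X Y ∘ pair X (T Y) x)
      (lhs-linear₂ (to (dirac X) x)) (strength-linear X Y x)
      λ y → trans (lhs-δ₂ (to (dirac X) x) y) (trans (t′-δ Y x y) (sym (strength-δ X Y x y)))

    rhs-δ₁ : (x : DCPO.Carrier X) (ν : MinimalValuation Y) → to rhs (to (dirac X) x , ν) ≈ᵐ to (strength X Y) (x , ν)
    rhs-δ₁ x ν = trans (resp-≈ (bind (strength X Y)) (t′-δ (T Y) x ν)) (bind-δ (strength X Y) (x , ν))

  strength-commutative : bind (t′ X Y) ∘ strength (T X) Y ≐ bind (strength X Y) ∘ t′ X (T Y)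
  strength-commutative (μ , ν) = linearMap-ext
    (lhs ∘ swap (T Y) (T X) ∘ pair (T Y) (T X) ν) (rhs ∘ swap (T Y) (T X) ∘ pair (T Y) (T X) ν)
    (lhs-linear₁ ν)
    -- On this side `ν` is the parameter of the inner strength, so linearity in `μ` is that of a
    -- composite.
    (linearMap-∘ (t′ X (T Y) ∘ swap (T Y) (T X) ∘ pair (T Y) (T X) ν) (bind (strength X Y))
      (t′-linear (T Y) ν) (bind-linear (strength X Y)))
    (λ x → trans (lhs-δ₁ x ν) (sym (rhs-δ₁ x ν)))
    μ

minimalCommutativeMonad : CommutativeMonad (𝐕ₘ {ℓ})
minimalCommutativeMonad = record
  { monad       = minimalMonad
  ; strength    = minimalStrength
  ; commutative = strength-commutative
  }

corollary5p11 : (ℓ : Level) →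
    Σ[ M ∈ CommutativeMonad (𝐕ₘ {ℓ}) ]
      let open CommutativeMonad M
          open DCPO (𝐑 {ℓ}) using (_≈_)
      in
      ((X : DCPO ℓ) (x : DCPO.Carrier X) (U : Open X) →
         to (η X) x ⟦ U ⟧ ≈ δ x U)
      × ((X Y : DCPO ℓ) (f : X ⇒ 𝐕ₘ Y) (μ : MinimalValuation X) (V : Open Y) →
         to (f †) μ ⟦ V ⟧ ≈ ∫ (evaluateAt V ∘ f) (valuation μ))
      × ((X Y : DCPO ℓ) (x : DCPO.Carrier X) (ν : MinimalValuation Y) (W : Open (X ⊗ Y)) →
         to (t X Y) (x , ν) ⟦ W ⟧ ≈ ν ⟦ slice X Y W x ⟧)
corollary5p11 ℓ = minimalCommutativeMonad , dirac-value , (λ X Y → bind-value) , strength-value
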